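{- Let $a\in\{1,3\}$. Then the sequence $$A(n)=\sum_{k=0}^n(-1)^k\binom{n}{k}^a\binom{4n-5k}{3n}\qquad(n\ge0)$$ satisfies the Lucas congruences: for every prime $p$ and every $n\ge0$ with base-$p$ expansion $n=n_0+n_1p+\cdots+n_rp^r$, $A(n)\equiv A(n_0)A(n_1)\cdots A(n_r)\pmod p$.
   Context: For integers $m\ge0$ and any number $x$, $\binom{x}{m}=\frac{x(x-1)\cdots(x-m+1)}{m!}$ (so the upper entry $4n-5k$ may be negative). -}

module Defs where

open import Data.Nat as ℕ using (ℕ; zero; suc; _!; _<_)
open import Data.Nat.Properties using (_!≢0)
open import Data.Nat.Combinatorics using (_C_)
open import Data.Integer as ℤ using (ℤ; +_; -_; _-_; _*_; _/ℕ_; 1ℤ; 0ℤ)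
open import Data.List as List using (List; []; _∷_; map; zip; upTo; foldr)

falling : ℤ → ℕ → ℤ
falling x zero    = 1ℤ
falling x (suc m) = x * falling (x - 1ℤ) m

binomℤ : ℤ → ℕ → ℤ
binomℤ x m = _/ℕ_ (falling x m) (m !) {{m !≢0}}

sgn : ℕ → ℤ
sgn zero    = 1ℤ
sgn (suc k) = - sgn k

sumTo : ℕ → (ℕ → ℤ) → ℤ
sumTo n f = List.foldr ℤ._+_ 0ℤ (map f (upTo (suc n)))

A : ℕ → ℕ → ℤ
A a n = sumTo n λ k →
  sgn k * ((+ (n C k)) ℤ.^ a) * binomℤ (+ (4 ℕ.* n) - + (5 ℕ.* k)) (3 ℕ.* n)

digitsValue : ℕ → List ℕ → ℕ
digitsValue p []       = 0
digitsValue p (d ∷ ds) = d ℕ.+ p ℕ.* digitsValue p ds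

prodA : ℕ → List ℕ → ℤ
prodA a []       = 1ℤ
prodA a (d ∷ ds) = A a d * prodA a ds

{-# OPTIONS --safe #-}
module Submission where

-- With y = v - v⁻¹ one has C(z,m) = [yᵐ] Φ_{2z-m+1}(y) for the Fibonacci polynomials Φ_M.
-- The Laurent polynomial S_n(v) = Σ_k (-1)ᵏ C(n,k)ᵃ v^(5n-10k) is invariant under v ↦ - v⁻¹,
-- hence a polynomial in y, and A(n) is its coefficient at y^(3n).  For n = n₀ + p n₁ with
-- n₀ < p, Lucas' theorem and v^p - v^(-p) ≡ y^p give S_n(y) ≡ S_{n₀}(y) S_{n₁}(y^p) mod p.
-- In the resulting sum for A(n), the term that pairs y^(3n₁-i) of S_{n₁} with y^(3n₀+pi) of
-- S_{n₀} vanishes unless i = 0: for odd i by parity, for i ≥ 2 and i ≤ -3 by degree, and for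
-- i = -2 because [y^(3n₀-2p)] S_{n₀} is modulo p a sum over all residues k of a polynomial
-- in k of degree less than p - 1.

open import Defs
open import Data.Nat as ℕ using (ℕ; zero; suc; _<_; _≤_; z≤n; s≤s; _∸_; _!)
import Data.Nat.Properties as ℕP
import Data.Nat.Divisibility as ℕD
import Data.Nat.Tactic.RingSolver as ℕR
open import Data.Nat.Combinatorics using (_C_; nCk+nC[k+1]≡[n+1]C[k+1]; nCk≡nC[n∸k]; nCn≡1; nC1≡n; k>n⇒nCk≡0)
open import Data.Nat.Primality using (Prime; euclidsLemma; prime⇒nonTrivial)
open import Data.Integer using (ℤ; +_; -[1+_]; +[1+_]; -_; _+_; _-_; _*_; _^_; _/ℕ_; _%ℕ_; ∣_∣; 0ℤ; 1ℤ)
import Data.Integer as ℤ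
import Data.Integer.Properties as ℤP
open import Data.Integer.Divisibility using (_∣_)
open import Data.Integer.Divisibility.Signed using (divides; ∣ᵤ⇒∣; ∣⇒∣ᵤ)
open import Data.Integer.DivMod using (a≡a%ℕn+[a/ℕn]*n; n%ℕd<d)
open import Data.Integer.Tactic.RingSolver using (solve-∀)
open import Algebra.Bundles using (AbelianGroup)
open import Algebra.Properties.Group (AbelianGroup.group ℤP.+-0-abelianGroup) using (∙-cancelʳ)
open import Data.Sum using (_⊎_; inj₁; inj₂)
open import Data.Product using (_×_; _,_; proj₁)
open import Data.List using (List; []; _∷_; foldr; applyUpTo)
open import Data.List.Properties using (map-upTo)
open import Data.List.Relation.Unary.All using (All; []; _∷_)
open import Function using (_∘_)
open import Relation.Nullary using (yes; no; contradiction)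
open import Relation.Binary using (Setoid; tri<; tri≈; tri>)
open import Relation.Binary.PropositionalEquality using (_≡_; _≢_; refl; sym; trans; cong; cong₂; subst; module ≡-Reasoning)
import Relation.Binary.Reasoning.Setoid as SetoidReasoning

-- The code contains neither a polynomial ring nor the variable v. A polynomial in y is its
-- coefficient function ℕ → ℤ, multiplication by y is `shift 1`, and v acts only through Φ_{M+2} = y
-- Φ_{M+1} + Φ_M, run over all integers M. For this reason the Frobenius map is stated for commuting
-- operators: (T + S)^p ≡ T^p + S^p under an arbitrary linear functional. Four choices of T and S
-- supply all the arithmetic modulo p: (-1)^p ≡ -1 (including p = 2), the step of Lucas' theorem,
-- v^p ≡ y^p + v^(-p), and, with T the difference operator, the vanishing of a sum of a low-degree
-- polynomial over all residues.
--
-- The delicate pairing is the one at y^(3n₀-2p), a genuine exponent of S_{n₀} once 3n₀ ≥ 2p. Put m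
-- = p - 1 - n₀. Modulo p the weights are polynomials in k of degree at most 3m, and the remaining
-- factor is a binomial coefficient of degree 3n₀ - 2p in k. The total 3m + 3n₀ - 2p = p - 3 is
-- independent of n₀ and just small enough.

∑ : ℕ → (ℕ → ℤ) → ℤ
∑ zero    f = 0ℤ
∑ (suc n) f = f 0 + ∑ n (f ∘ suc)

-- Finite sums of integers

sumTo≡∑ : ∀ n f → sumTo n f ≡ ∑ (suc n) f
sumTo≡∑ n f = trans (cong (foldr _+_ 0ℤ) (map-upTo f (suc n))) (go (suc n) f)
  where
  go : ∀ n f → foldr _+_ 0ℤ (applyUpTo f n) ≡ ∑ n f
  go zero    f = refl
  go (suc n) f = cong (_+_ (f 0)) (go n (f ∘ suc))

∑-cong : ∀ n {f g} → (∀ i → i < n → f i ≡ g i) → ∑ n f ≡ ∑ n g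
∑-cong zero    h = refl
∑-cong (suc n) h = cong₂ _+_ (h 0 (s≤s z≤n)) (∑-cong n λ i i<n → h (suc i) (s≤s i<n))

∑-zero : ∀ n {f} → (∀ i → i < n → f i ≡ 0ℤ) → ∑ n f ≡ 0ℤ
∑-zero zero    h = refl
∑-zero (suc n) h = cong₂ _+_ (h 0 (s≤s z≤n)) (∑-zero n λ i i<n → h (suc i) (s≤s i<n))

∑-+ : ∀ n f g → ∑ n (λ i → f i + g i) ≡ ∑ n f + ∑ n g
∑-+ zero    f g = refl
∑-+ (suc n) f g =
  trans (cong (_+_ (f 0 + g 0)) (∑-+ n (f ∘ suc) (g ∘ suc))) (lem (f 0) (g 0) _ _)
  where
  lem : ∀ a b c d → (a + b) + (c + d) ≡ (a + c) + (b + d)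
  lem = solve-∀

∑-*ˡ : ∀ n c f → ∑ n (λ i → c * f i) ≡ c * ∑ n f
∑-*ˡ zero    c f = sym (ℤP.*-zeroʳ c)
∑-*ˡ (suc n) c f =
  trans (cong (_+_ (c * f 0)) (∑-*ˡ n c (f ∘ suc))) (sym (ℤP.*-distribˡ-+ c (f 0) _))

∑-split : ∀ m n f → ∑ (m ℕ.+ n) f ≡ ∑ m f + ∑ n (λ i → f (m ℕ.+ i))
∑-split zero    n f = sym (ℤP.+-identityˡ _)
∑-split (suc m) n f =
  trans (cong (_+_ (f 0)) (∑-split m n (f ∘ suc))) (sym (ℤP.+-assoc (f 0) _ _))

∑-last : ∀ n f → ∑ (suc n) f ≡ ∑ n f + f n
∑-last zero    f = ℤP.+-comm (f 0) 0ℤ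
∑-last (suc n) f = trans (cong (_+_ (f 0)) (∑-last n (f ∘ suc))) (sym (ℤP.+-assoc (f 0) _ _))

∑-extend : ∀ m n f → (∀ i → m ≤ i → f i ≡ 0ℤ) → m ≤ n → ∑ n f ≡ ∑ m f
∑-extend m n f h m≤n = begin
  ∑ n f                                     ≡⟨ cong (λ k → ∑ k f) (ℕP.m+[n∸m]≡n m≤n) ⟨
  ∑ (m ℕ.+ (n ∸ m)) f                       ≡⟨ ∑-split m (n ∸ m) f ⟩
  ∑ m f + ∑ (n ∸ m) (λ i → f (m ℕ.+ i))     ≡⟨ cong (_+_ (∑ m f)) (∑-zero (n ∸ m) λ i _ → h _ (ℕP.m≤m+n m i)) ⟩
  ∑ m f + 0ℤ                                ≡⟨ ℤP.+-identityʳ _ ⟩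
  ∑ m f                                     ∎
  where open ≡-Reasoning

∑-swap : ∀ m n (f : ℕ → ℕ → ℤ) → ∑ m (λ i → ∑ n (f i)) ≡ ∑ n (λ j → ∑ m (λ i → f i j))
∑-swap zero    n f = sym (∑-zero n λ _ _ → refl)
∑-swap (suc m) n f =
  trans (cong (_+_ (∑ n (f 0))) (∑-swap m n (f ∘ suc))) (sym (∑-+ n (f 0) _))

∑-blocks : ∀ p q f → ∑ (q ℕ.* p) f ≡ ∑ q (λ j → ∑ p (λ i → f (i ℕ.+ p ℕ.* j)))
∑-blocks p zero    f = refl
∑-blocks p (suc q) f = trans (∑-split p (q ℕ.* p) f) (cong₂ _+_
  (∑-cong p λ i _ → cong f (first p i))
  (trans (∑-blocks p q (λ i → f (p ℕ.+ i)))
    (∑-cong q λ j _ → ∑-cong p λ i _ → cong f (rest p i j))))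
  where
  first : ∀ p i → i ≡ i ℕ.+ p ℕ.* 0
  first = ℕR.solve-∀
  rest : ∀ p i j → p ℕ.+ (i ℕ.+ p ℕ.* j) ≡ i ℕ.+ p ℕ.* suc j
  rest = ℕR.solve-∀

∑-reverse : ∀ n f → ∑ (suc n) f ≡ ∑ (suc n) (λ k → f (n ∸ k))
∑-reverse zero    f = refl
∑-reverse (suc n) f = begin
  f 0 + ∑ (suc n) (f ∘ suc)                       ≡⟨ cong (_+_ (f 0)) (∑-reverse n (f ∘ suc)) ⟩
  f 0 + ∑ (suc n) (λ k → f (suc (n ∸ k)))         ≡⟨ ℤP.+-comm (f 0) _ ⟩
  ∑ (suc n) (λ k → f (suc (n ∸ k))) + f 0
    ≡⟨ cong₂ _+_ (∑-cong (suc n) λ { k (s≤s k≤n) → cong f (sym (ℕP.+-∸-assoc 1 k≤n)) })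
                 (cong f (sym (ℕP.n∸n≡0 n))) ⟩
  ∑ (suc n) (λ k → f (suc n ∸ k)) + f (n ∸ n)     ≡⟨ ∑-last (suc n) (λ k → f (suc n ∸ k)) ⟨
  ∑ (suc (suc n)) (λ k → f (suc n ∸ k))           ∎
  where open ≡-Reasoning

-- Congruences modulo an integer

module Modulo (d : ℤ) where

  infix 4 _≈_
  -- The explicit cofactor reduces each closure law to one ring identity; as a record, the relation
  -- lets x and y be inferred from its proofs.
  record _≈_ (x y : ℤ) : Set where
    constructor by
    field
      quotient : ℤ
      equality : x ≡ y + quotient * d

  ≈-reflexive : ∀ {x y} → x ≡ y → x ≈ y
  ≈-reflexive {x} refl = by 0ℤ (lem x d)
    where
    lem : ∀ x d → x ≡ x + 0ℤ * d
    lem = solve-∀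

  ≈-refl : ∀ {x} → x ≈ x
  ≈-refl = ≈-reflexive refl

  ≈-sym : ∀ {x y} → x ≈ y → y ≈ x
  ≈-sym {y = y} (by q refl) = by (- q) (lem y q d)
    where
    lem : ∀ y q d → y ≡ y + q * d + (- q) * d
    lem = solve-∀

  ≈-trans : ∀ {x y z} → x ≈ y → y ≈ z → x ≈ z
  ≈-trans {z = z} (by q refl) (by r refl) = by (q + r) (lem z q r d)
    where
    lem : ∀ z q r d → z + r * d + q * d ≡ z + (q + r) * d
    lem = solve-∀

  ≈-setoid : Setoid _ _
  ≈-setoid = record
    { Carrier = ℤ ; _≈_ = _≈_
    ; isEquivalence = record { refl = ≈-refl ; sym = ≈-sym ; trans = ≈-trans } }

  module ≈-Reasoning = SetoidReasoning ≈-setoid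

  +-cong : ∀ {x y u v} → x ≈ y → u ≈ v → x + u ≈ y + v
  +-cong {y = y} {v = v} (by q refl) (by r refl) = by (q + r) (lem y v q r d)
    where
    lem : ∀ y v q r d → y + q * d + (v + r * d) ≡ y + v + (q + r) * d
    lem = solve-∀

  *-cong : ∀ {x y u v} → x ≈ y → u ≈ v → x * u ≈ y * v
  *-cong {y = y} {v = v} (by q refl) (by r refl) =
    by (q * v + y * r + q * r * d) (lem y v q r d)
    where
    lem : ∀ y v q r d → (y + q * d) * (v + r * d) ≡ y * v + (q * v + y * r + q * r * d) * d
    lem = solve-∀

  neg-cong : ∀ {x y} → x ≈ y → - x ≈ - y
  neg-cong {y = y} (by q refl) = by (- q) (lem y q d)
    where
    lem : ∀ y q d → - (y + q * d) ≡ - y + (- q) * d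
    lem = solve-∀

  ^-cong : ∀ {x y} a → x ≈ y → x ^ a ≈ y ^ a
  ^-cong zero    e = ≈-refl
  ^-cong (suc a) e = *-cong e (^-cong a e)

  +-zeroˡ : ∀ {x y} → x ≈ 0ℤ → x + y ≈ y
  +-zeroˡ {y = y} e = ≈-trans (+-cong e ≈-refl) (≈-reflexive (ℤP.+-identityˡ y))

  +-zeroʳ : ∀ {x y} → y ≈ 0ℤ → x + y ≈ x
  +-zeroʳ {x} e = ≈-trans (+-cong (≈-refl {x}) e) (≈-reflexive (ℤP.+-identityʳ x))

  *-zeroˡ : ∀ {x} y → x ≈ 0ℤ → x * y ≈ 0ℤ
  *-zeroˡ y e = ≈-trans (*-cong e (≈-refl {y})) (≈-reflexive (ℤP.*-zeroˡ y))

  *-zeroʳ : ∀ x {y} → y ≈ 0ℤ → x * y ≈ 0ℤ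
  *-zeroʳ x e = ≈-trans (*-cong (≈-refl {x}) e) (≈-reflexive (ℤP.*-zeroʳ x))

  ∑-≈ : ∀ n {f g} → (∀ i → i < n → f i ≈ g i) → ∑ n f ≈ ∑ n g
  ∑-≈ zero    h = ≈-refl
  ∑-≈ (suc n) h = +-cong (h 0 (s≤s z≤n)) (∑-≈ n λ i i<n → h (suc i) (s≤s i<n))

  ∑-≈0 : ∀ n {f} → (∀ i → i < n → f i ≈ 0ℤ) → ∑ n f ≈ 0ℤ
  ∑-≈0 n h = ≈-trans (∑-≈ n h) (≈-reflexive (∑-zero n λ _ _ → refl))

  ∑-single : ∀ n f i → i < n → (∀ j → j < n → j ≢ i → f j ≈ 0ℤ) → ∑ n f ≈ f i
  ∑-single (suc n) f zero    i<n       h =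
    +-zeroʳ (∑-≈0 n λ j j<n → h (suc j) (s≤s j<n) λ ())
  ∑-single (suc n) f (suc i) (s≤s i<n) h =
    ≈-trans (+-zeroˡ (h 0 (s≤s z≤n) λ ()))
      (∑-single n (f ∘ suc) i i<n λ j j<n j≢i → h (suc j) (s≤s j<n) (j≢i ∘ ℕP.suc-injective))

  ∣⇒≈0 : ∀ {x} → d ∣ x → x ≈ 0ℤ
  ∣⇒≈0 {x} d∣x with ∣ᵤ⇒∣ d∣x
  ... | divides q eq = by q (trans eq (sym (ℤP.+-identityˡ _)))

  ≈⇒∣ : ∀ {x y} → x ≈ y → d ∣ x - y
  ≈⇒∣ {y = y} (by q refl) = ∣⇒∣ᵤ (divides q (lem y q d))
    where
    lem : ∀ y q d → y + q * d - y ≡ q * d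
    lem = solve-∀

-- Natural binomial coefficients and their divisibility by a prime

pascal : ∀ n k → + (suc n C suc k) ≡ + (n C k) + + (n C suc k)
pascal n k = cong +_ (sym (nCk+nC[k+1]≡[n+1]C[k+1] n k))

C-zero : ∀ n → n C 0 ≡ 1
C-zero n = trans (nCk≡nC[n∸k] {0} {n} z≤n) (nCn≡1 n)

absorption : ∀ n k → suc k ℕ.* (suc n C suc k) ≡ suc n ℕ.* (n C k)
absorption zero    zero    = refl
absorption zero    (suc k) = begin
  suc (suc k) ℕ.* (1 C suc (suc k))  ≡⟨ cong (suc (suc k) ℕ.*_) (k>n⇒nCk≡0 {1} {suc (suc k)} (s≤s (s≤s z≤n))) ⟩
  suc (suc k) ℕ.* 0                  ≡⟨ ℕP.*-zeroʳ (suc (suc k)) ⟩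
  0                                  ≡⟨ cong (1 ℕ.*_) (k>n⇒nCk≡0 {0} {suc k} (s≤s z≤n)) ⟨
  1 ℕ.* (0 C suc k)                  ∎
  where open ≡-Reasoning
absorption (suc n) zero    = begin
  1 ℕ.* (suc (suc n) C 1)      ≡⟨ ℕP.*-identityˡ _ ⟩
  suc (suc n) C 1              ≡⟨ nC1≡n (suc (suc n)) ⟩
  suc (suc n)                  ≡⟨ ℕP.*-identityʳ _ ⟨
  suc (suc n) ℕ.* 1            ≡⟨ cong (suc (suc n) ℕ.*_) (C-zero (suc n)) ⟨
  suc (suc n) ℕ.* (suc n C 0)  ∎
  where open ≡-Reasoning
absorption (suc n) (suc k) = begin
  suc (suc k) ℕ.* (suc (suc n) C suc (suc k))
    ≡⟨ cong (suc (suc k) ℕ.*_) (nCk+nC[k+1]≡[n+1]C[k+1] (suc n) (suc k)) ⟨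
  suc (suc k) ℕ.* (u ℕ.+ v)
    ≡⟨ expand k u v ⟩
  suc k ℕ.* u ℕ.+ suc (suc k) ℕ.* v ℕ.+ u
    ≡⟨ cong (ℕ._+ u) (cong₂ ℕ._+_ (absorption n k) (absorption n (suc k))) ⟩
  suc n ℕ.* (n C k) ℕ.+ suc n ℕ.* (n C suc k) ℕ.+ u
    ≡⟨ cong (ℕ._+ u) (ℕP.*-distribˡ-+ (suc n) (n C k) (n C suc k)) ⟨
  suc n ℕ.* (n C k ℕ.+ n C suc k) ℕ.+ u
    ≡⟨ cong (λ x → suc n ℕ.* x ℕ.+ u) (nCk+nC[k+1]≡[n+1]C[k+1] n k) ⟩
  suc n ℕ.* u ℕ.+ u
    ≡⟨ ℕP.+-comm (suc n ℕ.* u) u ⟩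
  suc (suc n) ℕ.* u ∎
  where
  open ≡-Reasoning
  u v : ℕ
  u = suc n C suc k
  v = suc n C suc (suc k)
  expand : ∀ k u v → suc (suc k) ℕ.* (u ℕ.+ v) ≡ suc k ℕ.* u ℕ.+ suc (suc k) ℕ.* v ℕ.+ u
  expand = ℕR.solve-∀

-- Absorption makes p a divisor of k C(p,k), and p cannot divide the smaller positive number k.
prime∣C : ∀ {p} → Prime p → ∀ {k} → 0 < k → k < p → p ℕD.∣ (p C k)
prime∣C {suc p} pr {suc k} _ k<p
  with euclidsLemma (suc k) (suc p C suc k) pr
         (subst (suc p ℕD.∣_) (sym (absorption p k)) (ℕD.m∣m*n (p C k)))
... | inj₁ p∣k = contradiction p∣k (ℕD.>⇒∤ k<p)
... | inj₂ p∣C = p∣C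

-- The binomial theorem for a sum of commuting operators T + S:
-- G a b i stands for a linear functional applied to (T + S)ᵃ Sᵇ Tⁱ.
binomial-expansion : (G : ℕ → ℕ → ℕ → ℤ) →
  (∀ a b i → G (suc a) b i ≡ G a b (suc i) + G a (suc b) i) →
  ∀ n b i → G n b i ≡ ∑ (suc n) (λ j → + (n C j) * G 0 (b ℕ.+ (n ∸ j)) (i ℕ.+ j))
binomial-expansion G step zero b i = sym (begin
  1ℤ * G 0 (b ℕ.+ 0) (i ℕ.+ 0) + 0ℤ  ≡⟨ ℤP.+-identityʳ _ ⟩
  1ℤ * G 0 (b ℕ.+ 0) (i ℕ.+ 0)       ≡⟨ ℤP.*-identityˡ _ ⟩
  G 0 (b ℕ.+ 0) (i ℕ.+ 0)            ≡⟨ cong₂ (G 0) (ℕP.+-identityʳ b) (ℕP.+-identityʳ i) ⟩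
  G 0 b i                            ∎)
  where open ≡-Reasoning
binomial-expansion G step (suc n) b i = begin
  G (suc n) b i
    ≡⟨ step n b i ⟩
  G n b (suc i) + G n (suc b) i
    ≡⟨ cong₂ _+_ (binomial-expansion G step n b (suc i)) (binomial-expansion G step n (suc b) i) ⟩
  ∑ (suc n) (λ j → + (n C j) * G 0 (b ℕ.+ (n ∸ j)) (suc i ℕ.+ j)) + ∑ (suc n) low
    ≡⟨ cong₂ _+_
         (∑-cong (suc n) λ j _ → cong (λ x → + (n C j) * G 0 (b ℕ.+ (n ∸ j)) x) (sym (ℕP.+-suc i j)))
         (sym (∑-extend (suc n) (suc (suc n)) low (λ j n<j → vanish j n<j _) (ℕP.n≤1+n _))) ⟩
  ∑ (suc n) high + (low 0 + ∑ (suc n) (low ∘ suc))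
    ≡⟨ rearrange (∑ (suc n) high) (low 0) (∑ (suc n) (low ∘ suc)) ⟩
  low 0 + (∑ (suc n) high + ∑ (suc n) (low ∘ suc))
    ≡⟨ cong (_+_ (low 0)) (∑-+ (suc n) high (low ∘ suc)) ⟨
  low 0 + ∑ (suc n) (λ j → high j + low (suc j))
    ≡⟨ cong₂ _+_ head≡ (∑-cong (suc n) λ j _ → tail≡ j) ⟩
  ∑ (suc (suc n)) (λ j → + (suc n C j) * g j) ∎
  where
  open ≡-Reasoning
  g high low : ℕ → ℤ
  g j = G 0 (b ℕ.+ (suc n ∸ j)) (i ℕ.+ j)
  high j = + (n C j) * g (suc j)
  low j = + (n C j) * G 0 (suc b ℕ.+ (n ∸ j)) (i ℕ.+ j)

  vanish : ∀ j → n < j → ∀ x → + (n C j) * x ≡ 0ℤ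
  vanish j n<j x = cong (λ c → + c * x) (k>n⇒nCk≡0 n<j)

  rearrange : ∀ x y z → x + (y + z) ≡ y + (x + z)
  rearrange = solve-∀

  head≡ : low 0 ≡ + (suc n C 0) * g 0
  head≡ = cong₂ (λ c x → + c * G 0 x (i ℕ.+ 0))
    (trans (C-zero n) (sym (C-zero (suc n)))) (sym (ℕP.+-suc b n))

  low≡ : ∀ j → low (suc j) ≡ + (n C suc j) * g (suc j)
  low≡ j with j ℕ.<? n
  ... | yes j<n = cong (λ x → + (n C suc j) * G 0 x (i ℕ.+ suc j))
                    (trans (sym (ℕP.+-suc b (n ∸ suc j))) (cong (b ℕ.+_) (sym (ℕP.+-∸-assoc 1 j<n))))
  ... | no  j≮n = trans (vanish (suc j) (s≤s (ℕP.≮⇒≥ j≮n)) _)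
                    (sym (vanish (suc j) (s≤s (ℕP.≮⇒≥ j≮n)) _))

  tail≡ : ∀ j → high j + low (suc j) ≡ + (suc n C suc j) * g (suc j)
  tail≡ j = trans (cong (_+_ (high j)) (low≡ j))
    (trans (sym (ℤP.*-distribʳ-+ (g (suc j)) (+ (n C j)) (+ (n C suc j))))
      (cong (_* g (suc j)) (sym (pascal n j))))

-- Signs and multiplication by powers of y

sgn-+ : ∀ m n → sgn (m ℕ.+ n) ≡ sgn m * sgn n
sgn-+ zero    n = sym (ℤP.*-identityˡ (sgn n))
sgn-+ (suc m) n = trans (cong -_ (sgn-+ m n)) (ℤP.neg-distribˡ-* (sgn m) (sgn n))

sgn² : ∀ n → sgn n * sgn n ≡ 1ℤ
sgn² zero    = refl
sgn² (suc n) = trans (lem (sgn n)) (sgn² n)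
  where
  lem : ∀ x → - x * - x ≡ x * x
  lem = solve-∀

-- shift j f is the sequence of coefficients of yʲ · Σ f(m) yᵐ.
shift : ℕ → (ℕ → ℤ) → ℕ → ℤ
shift zero    f m       = f m
shift (suc j) f zero    = 0ℤ
shift (suc j) f (suc m) = shift j f m

shift-+ : ∀ j f m → shift j f (j ℕ.+ m) ≡ f m
shift-+ zero    f m = refl
shift-+ (suc j) f m = shift-+ j f m

shift-< : ∀ j f m → m < j → shift j f m ≡ 0ℤ
shift-< (suc j) f zero    _         = refl
shift-< (suc j) f (suc m) (s≤s m<j) = shift-< j f m m<j

shift-∑ : ∀ j n (c : ℕ → ℤ) (f : ℕ → ℕ → ℤ) m →
  shift j (λ i → ∑ n (λ k → c k * f k i)) m ≡ ∑ n (λ k → c k * shift j (f k) m)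
shift-∑ zero    n c f m       = refl
shift-∑ (suc j) n c f zero    = sym (∑-zero n λ k _ → ℤP.*-zeroʳ (c k))
shift-∑ (suc j) n c f (suc m) = shift-∑ j n c f m

pascal-shift : ∀ j n m → shift j (λ k → + (suc n C k)) m
  ≡ shift (suc j) (λ k → + (n C k)) m + shift j (λ k → + (n C k)) m
pascal-shift zero    n zero    = cong +_ (trans (C-zero (suc n)) (sym (C-zero n)))
pascal-shift zero    n (suc m) = pascal n m
pascal-shift (suc j) n zero    = refl
pascal-shift (suc j) n (suc m) = pascal-shift j n m

-- The Frobenius congruence and Lucas' theorem

module Frobenius (p : ℕ) (pr : Prime p) where

  open Modulo (+ p) public

  1<p : 1 < p
  1<p = ℕ.nonTrivial⇒n>1 p {{prime⇒nonTrivial pr}}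

  0<p : 0 < p
  0<p = ℕP.<-trans (s≤s z≤n) 1<p

  C≈0 : ∀ {k} → 0 < k → k < p → + (p C k) ≈ 0ℤ
  C≈0 0<k k<p = ∣⇒≈0 (prime∣C pr 0<k k<p)

  -- Every inner term of the expansion of (T + S)^p carries some C(p,j) with 0 < j < p. The two ends
  -- are S^p, which is `G 0 p 0`, and T^p, which is `G 0 0 p`.
  frobenius : (G : ℕ → ℕ → ℕ → ℤ) →
    (∀ a b i → G (suc a) b i ≡ G a b (suc i) + G a (suc b) i) →
    G p 0 0 ≈ G 0 p 0 + G 0 0 p
  frobenius G step = begin
    G p 0 0                          ≡⟨ binomial-expansion G step p 0 0 ⟩
    ∑ (suc p) g                      ≡⟨ ∑-last p g ⟩
    ∑ p g + g p                      ≈⟨ +-cong first (≈-reflexive last) ⟩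
    G 0 p 0 + G 0 0 p                ∎
    where
    open ≈-Reasoning
    g : ℕ → ℤ
    g j = + (p C j) * G 0 (p ∸ j) j
    first : ∑ p g ≈ G 0 p 0
    first = ≈-trans
      (∑-single p g 0 0<p λ
        { zero    _   0≢0 → contradiction refl 0≢0
        ; (suc j) j<p _   → *-zeroˡ _ (C≈0 (s≤s z≤n) j<p) })
      (≈-reflexive (trans (cong (λ c → + c * G 0 p 0) (C-zero p)) (ℤP.*-identityˡ _)))
    last : g p ≡ G 0 0 p
    last = trans (cong₂ (λ c x → + c * G 0 x p) (nCn≡1 p) (ℕP.n∸n≡0 p)) (ℤP.*-identityˡ _)

  sgn-p : - sgn p ≈ 1ℤ
  sgn-p = begin
    - sgn p                ≡⟨ ℤP.+-identityʳ (- sgn p) ⟨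
    - sgn p + 0ℤ           ≡⟨ cong (_+_ (- sgn p)) (G-pos 0<p) ⟨
    - sgn p + G p 0 0      ≈⟨ +-cong (≈-refl {(- sgn p)}) (frobenius G step) ⟩
    - sgn p + (1ℤ + sgn p) ≡⟨ lem (sgn p) ⟩
    1ℤ                     ∎
    where
    open ≈-Reasoning
    -- T = -1 and S = 1: positive powers of T + S vanish, so the congruence reads 0 ≡ 1 + (-1)^p,
    -- without a separate case for p = 2.
    G : ℕ → ℕ → ℕ → ℤ
    G zero    b i = sgn i
    G (suc a) b i = 0ℤ
    G-pos : ∀ {a} → 0 < a → G a 0 0 ≡ 0ℤ
    G-pos (s≤s _) = refl
    step : ∀ a b i → G (suc a) b i ≡ G a b (suc i) + G a (suc b) i
    step zero    b i = sym (ℤP.+-inverseˡ (sgn i))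
    step (suc a) b i = refl
    lem : ∀ x → - x + (1ℤ + x) ≡ 1ℤ
    lem = solve-∀

  sgn-p* : ∀ k → sgn (p ℕ.* k) ≈ sgn k
  sgn-p* zero    = ≈-reflexive (cong sgn (ℕP.*-zeroʳ p))
  sgn-p* (suc k) = begin
    sgn (p ℕ.* suc k)      ≡⟨ cong sgn (ℕP.*-suc p k) ⟩
    sgn (p ℕ.+ p ℕ.* k)    ≡⟨ sgn-+ p (p ℕ.* k) ⟩
    sgn p * sgn (p ℕ.* k)  ≈⟨ *-cong (≈-refl {sgn p}) (sgn-p* k) ⟩
    sgn p * sgn k          ≡⟨ lem (sgn p) (sgn k) ⟩
    - sgn p * - sgn k      ≈⟨ *-cong sgn-p ≈-refl ⟩
    1ℤ * - sgn k           ≡⟨ ℤP.*-identityˡ _ ⟩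
    - sgn k                ∎
    where
    open ≈-Reasoning
    lem : ∀ x y → x * y ≡ - x * - y
    lem = solve-∀

  -- This is (1 + y)^(n+p) ≡ (1 + y)^n (1 + y^p), with T = y and S = 1 in the Frobenius congruence.
  C-+p : ∀ n m → + ((n ℕ.+ p) C m) ≈ + (n C m) + shift p (λ k → + (n C k)) m
  C-+p n m = ≈-trans (frobenius (λ a _ i → shift i (λ k → + ((n ℕ.+ a) C k)) m)
      (λ a _ i → trans (cong (λ x → shift i (λ k → + (x C k)) m) (ℕP.+-suc n a))
        (pascal-shift i (n ℕ.+ a) m)))
    (≈-reflexive (cong (λ x → + (x C m) + shift p (λ k → + (x C k)) m) (ℕP.+-identityʳ n)))

  -- Raising n₁ by one multiplies the generating function by 1 + y^p. Since k₀ < p, the shift by p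
  -- lowers exactly the digit k₁, so `C-+p` becomes Pascal's rule for C(n₁,k₁).
  lucas : ∀ {n₀ k₀} → n₀ < p → k₀ < p → ∀ n₁ k₁ →
    + ((n₀ ℕ.+ p ℕ.* n₁) C (k₀ ℕ.+ p ℕ.* k₁)) ≈ + (n₀ C k₀) * + (n₁ C k₁)
  lucas {n₀} {k₀} n₀<p k₀<p zero zero = ≈-reflexive (begin
    + ((n₀ ℕ.+ p ℕ.* 0) C (k₀ ℕ.+ p ℕ.* 0))  ≡⟨ cong₂ (λ x y → + (x C y)) (p*0 n₀) (p*0 k₀) ⟩
    + (n₀ C k₀)                              ≡⟨ ℤP.*-identityʳ _ ⟨
    + (n₀ C k₀) * 1ℤ                         ∎)
    where
    open ≡-Reasoning
    p*0 : ∀ x → x ℕ.+ p ℕ.* 0 ≡ x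
    p*0 x = trans (cong (x ℕ.+_) (ℕP.*-zeroʳ p)) (ℕP.+-identityʳ x)
  lucas {n₀} {k₀} n₀<p k₀<p zero (suc k₁) = ≈-reflexive (begin
    + ((n₀ ℕ.+ p ℕ.* 0) C (k₀ ℕ.+ p ℕ.* suc k₁))
      ≡⟨ cong +_ (k>n⇒nCk≡0 large) ⟩
    0ℤ
      ≡⟨ ℤP.*-zeroʳ (+ (n₀ C k₀)) ⟨
    + (n₀ C k₀) * 0ℤ
      ≡⟨ cong (λ c → + (n₀ C k₀) * + c) (k>n⇒nCk≡0 {0} {suc k₁} (s≤s z≤n)) ⟨
    + (n₀ C k₀) * + (0 C suc k₁) ∎)
    where
    open ≡-Reasoning
    large : n₀ ℕ.+ p ℕ.* 0 < k₀ ℕ.+ p ℕ.* suc k₁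
    large = ℕP.<-≤-trans
      (subst (_< p) (sym (trans (cong (n₀ ℕ.+_) (ℕP.*-zeroʳ p)) (ℕP.+-identityʳ n₀))) n₀<p)
      (ℕP.≤-trans (ℕP.m≤m*n p (suc k₁)) (ℕP.m≤n+m _ k₀))
  lucas {n₀} {k₀} n₀<p k₀<p (suc n₁) k₁ = begin
    + ((n₀ ℕ.+ p ℕ.* suc n₁) C (k₀ ℕ.+ p ℕ.* k₁))
      ≡⟨ cong (λ x → + (x C (k₀ ℕ.+ p ℕ.* k₁))) (reassoc p n₀ n₁) ⟩
    + ((n ℕ.+ p) C (k₀ ℕ.+ p ℕ.* k₁))
      ≈⟨ C-+p n (k₀ ℕ.+ p ℕ.* k₁) ⟩
    + (n C (k₀ ℕ.+ p ℕ.* k₁)) + shift p (λ k → + (n C k)) (k₀ ℕ.+ p ℕ.* k₁)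
      ≈⟨ +-cong (lucas n₀<p k₀<p n₁ k₁) (shifted k₁) ⟩
    + (n₀ C k₀) * + (n₁ C k₁) + + (n₀ C k₀) * shift 1 (λ k → + (n₁ C k)) k₁
      ≡⟨ ℤP.*-distribˡ-+ (+ (n₀ C k₀)) _ _ ⟨
    + (n₀ C k₀) * (+ (n₁ C k₁) + shift 1 (λ k → + (n₁ C k)) k₁)
      ≡⟨ cong (+ (n₀ C k₀) *_) (trans (ℤP.+-comm _ (shift 1 _ k₁)) (sym (pascal-shift 0 n₁ k₁))) ⟩
    + (n₀ C k₀) * + (suc n₁ C k₁) ∎
    where
    open ≈-Reasoning
    n : ℕ
    n = n₀ ℕ.+ p ℕ.* n₁
    reassoc : ∀ p n₀ n₁ → n₀ ℕ.+ p ℕ.* suc n₁ ≡ n₀ ℕ.+ p ℕ.* n₁ ℕ.+ p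
    reassoc = ℕR.solve-∀
    next : ∀ p k₀ k₁ → k₀ ℕ.+ p ℕ.* suc k₁ ≡ p ℕ.+ (k₀ ℕ.+ p ℕ.* k₁)
    next = ℕR.solve-∀
    shifted : ∀ k₁ → shift p (λ k → + (n C k)) (k₀ ℕ.+ p ℕ.* k₁)
      ≈ + (n₀ C k₀) * shift 1 (λ k → + (n₁ C k)) k₁
    shifted zero = ≈-reflexive (trans
      (shift-< p _ _ (subst (_< p) (sym (trans (cong (k₀ ℕ.+_) (ℕP.*-zeroʳ p)) (ℕP.+-identityʳ k₀))) k₀<p))
      (sym (ℤP.*-zeroʳ (+ (n₀ C k₀)))))
    shifted (suc k₁) = ≈-trans
      (≈-reflexive (trans (cong (shift p _) (next p k₀ k₁)) (shift-+ p _ _)))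
      (lucas n₀<p k₀<p n₁ k₁)

shift-* : ∀ j c f m → shift j (λ i → c * f i) m ≡ c * shift j f m
shift-* zero    c f m       = refl
shift-* (suc j) c f zero    = sym (ℤP.*-zeroʳ c)
shift-* (suc j) c f (suc m) = shift-* j c f m

shift-linear : ∀ j {f g h} → (∀ m → f m ≡ shift 1 g m + h m) →
  ∀ m → shift j f m ≡ shift (suc j) g m + shift j h m
shift-linear zero    eq m       = eq m
shift-linear (suc j) eq zero    = refl
shift-linear (suc j) eq (suc m) = shift-linear j eq m

x≡-x⇒x≡0 : ∀ x → x ≡ - x → x ≡ 0ℤ
x≡-x⇒x≡0 (+ zero)  _  = refl
x≡-x⇒x≡0 +[1+ n ]  ()
x≡-x⇒x≡0 -[1+ n ]  ()

ℤ-induction : (P : ℤ → Set) → P 0ℤ → (∀ z → P z → P (ℤ.suc z)) → (∀ z → P (ℤ.suc z) → P z) → ∀ z → P z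
ℤ-induction P base up down (+ zero)      = base
ℤ-induction P base up down +[1+ n ]      = up (+ n) (ℤ-induction P base up down (+ n))
ℤ-induction P base up down -[1+ zero ]   = down -[1+ zero ] base
ℤ-induction P base up down -[1+ suc n ]  = down -[1+ suc n ] (ℤ-induction P base up down -[1+ n ])

-- Fibonacci polynomials and binomial coefficients

fib : ℕ → ℕ → ℤ
fib zero          m       = 0ℤ
fib (suc zero)    zero    = 1ℤ
fib (suc zero)    (suc m) = 0ℤ
fib (suc (suc n)) m       = shift 1 (fib (suc n)) m + fib n m

-- The coefficients of the Fibonacci polynomials Φ_M(y), characterised by
-- v^M = Φ_M(y) v + Φ_{M-1}(y) where y = v - v⁻¹.
Φ : ℤ → ℕ → ℤ
Φ (+ n)     m = fib n m
Φ -[1+ n ]  m = sgn n * fib (suc n) m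

Φ-suc-neg : ∀ n m → Φ (ℤ.suc -[1+ n ]) m ≡ - sgn n * fib n m
Φ-suc-neg zero    m = refl
Φ-suc-neg (suc n) m = cong (_* fib (suc n) m) (sym (ℤP.neg-involutive (sgn n)))

Φ-recurrence : ∀ M m → Φ (ℤ.suc (ℤ.suc M)) m ≡ shift 1 (Φ (ℤ.suc M)) m + Φ M m
Φ-recurrence (+ n)        m       = refl
Φ-recurrence -[1+ zero ]  zero    = refl
Φ-recurrence -[1+ zero ]  (suc m) = refl
Φ-recurrence -[1+ suc n ] m       = begin
  Φ (ℤ.suc -[1+ n ]) m
    ≡⟨ Φ-suc-neg n m ⟩
  - sgn n * fib n m
    ≡⟨ lem (sgn n) (shift 1 (fib (suc n)) m) (fib n m) ⟩
  sgn n * shift 1 (fib (suc n)) m + - sgn n * (shift 1 (fib (suc n)) m + fib n m)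
    ≡⟨ cong (_+ - sgn n * fib (suc (suc n)) m) (shift-* 1 (sgn n) (fib (suc n)) m) ⟨
  shift 1 (Φ -[1+ n ]) m + Φ -[1+ suc n ] m ∎
  where
  open ≡-Reasoning
  lem : ∀ c x y → - c * y ≡ c * x + - c * (x + y)
  lem = solve-∀

fib-degree : ∀ n m → n ≤ m → fib n m ≡ 0ℤ
fib-degree zero          m       _         = refl
fib-degree (suc zero)    (suc m) _         = refl
fib-degree (suc (suc n)) (suc m) (s≤s n≤m) =
  cong₂ _+_ (fib-degree (suc n) m n≤m) (fib-degree n (suc m) (ℕP.m≤n⇒m≤1+n (ℕP.<⇒≤ n≤m)))

Φ-degree : ∀ M m → ∣ M ∣ ≤ m → Φ M m ≡ 0ℤ
Φ-degree (+ n)    m h = fib-degree n m h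
Φ-degree -[1+ n ] m h = trans (cong (sgn n *_) (fib-degree (suc n) m h)) (ℤP.*-zeroʳ (sgn n))

-- Φ_n contains only powers y^m with m and n of opposite parity. For equal parities the identity
-- reads x = -x; this form avoids a case distinction on parity.
fib-parity : ∀ n m → fib n m ≡ - (sgn n * sgn m) * fib n m
fib-parity zero          m       = sym (ℤP.*-zeroʳ (- (1ℤ * sgn m)))
fib-parity (suc zero)    zero    = refl
fib-parity (suc zero)    (suc m) = sym (ℤP.*-zeroʳ (- (- 1ℤ * - sgn m)))
fib-parity (suc (suc n)) zero    = trans (cong (_+_ 0ℤ) (fib-parity n zero)) (lem (sgn n) (fib n 0))
  where
  lem : ∀ s x → 0ℤ + - (s * 1ℤ) * x ≡ - (- - s * 1ℤ) * (0ℤ + x)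
  lem = solve-∀
fib-parity (suc (suc n)) (suc m) =
  trans (cong₂ _+_ (fib-parity (suc n) m) (fib-parity n (suc m)))
    (lem (sgn n) (sgn m) (fib (suc n) m) (fib n (suc m)))
  where
  lem : ∀ s t x y → - (- s * t) * x + - (s * - t) * y ≡ - (- - s * - t) * (x + y)
  lem = solve-∀

Φ-parity : ∀ M m → Φ M m ≡ - (sgn ∣ M ∣ * sgn m) * Φ M m
Φ-parity (+ n)    m = fib-parity n m
Φ-parity -[1+ n ] m = trans (cong (sgn n *_) (fib-parity (suc n) m)) (lem (sgn n) (- (sgn (suc n) * sgn m)) (fib (suc n) m))
  where
  lem : ∀ a b c → a * (b * c) ≡ b * (a * c)
  lem = solve-∀

-- On the Binet form (v^M - (-v⁻¹)^M) / (v + v⁻¹) this is the exchange of the two roots v and -v⁻¹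
-- of t² = y t + 1.
Φ-neg : ∀ M m → Φ (- M) m ≡ - sgn ∣ M ∣ * Φ M m
Φ-neg (+ zero)  m = refl
Φ-neg +[1+ n ]  m = cong (_* fib (suc n) m) (sym (ℤP.neg-involutive (sgn n)))
Φ-neg -[1+ n ]  m = begin
  fib (suc n) m                            ≡⟨ ℤP.*-identityˡ _ ⟨
  1ℤ * fib (suc n) m                       ≡⟨ cong (_* fib (suc n) m) (sgn² n) ⟨
  sgn n * sgn n * fib (suc n) m            ≡⟨ lem (sgn n) (fib (suc n) m) ⟩
  - - sgn n * (sgn n * fib (suc n) m)      ∎
  where
  open ≡-Reasoning
  lem : ∀ s x → s * s * x ≡ - - s * (s * x)
  lem = solve-∀

-- C(z,m) is the coefficient of yᵐ in Φ_{2z-m+1}(y): both satisfy Pascal's rule on ℤ × ℕ.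
choose : ℤ → ℕ → ℤ
choose z m = Φ (ℤ.suc (z + z - + m)) m

-- It is the Fibonacci recurrence at M = 2z - m read at y^(m+1), where the factor y lowers the
-- exponent to m.
choose-pascal : ∀ z m → choose (ℤ.suc z) (suc m) ≡ choose z (suc m) + choose z m
choose-pascal z m = begin
  Φ (ℤ.suc (ℤ.suc z + ℤ.suc z - + suc m)) (suc m)
    ≡⟨ cong (λ M → Φ M (suc m)) (up z (+ m)) ⟩
  Φ (ℤ.suc (ℤ.suc (z + z - + m))) (suc m)
    ≡⟨ Φ-recurrence (z + z - + m) (suc m) ⟩
  choose z m + Φ (z + z - + m) (suc m)
    ≡⟨ ℤP.+-comm (choose z m) _ ⟩
  Φ (z + z - + m) (suc m) + choose z m
    ≡⟨ cong (λ M → Φ M (suc m) + choose z m) (same z (+ m)) ⟩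
  choose z (suc m) + choose z m ∎
  where
  open ≡-Reasoning
  up : ∀ z m → 1ℤ + (1ℤ + z + (1ℤ + z) - (1ℤ + m)) ≡ 1ℤ + (1ℤ + (z + z - m))
  up = solve-∀
  same : ∀ z m → z + z - m ≡ 1ℤ + (z + z - (1ℤ + m))
  same = solve-∀

choose-zeroʳ : ∀ z → choose z 0 ≡ 1ℤ
choose-zeroʳ = ℤ-induction _ refl (λ z h → trans (step z) h) (λ z h → trans (sym (step z)) h)
  where
  index : ∀ z → 1ℤ + (1ℤ + z + (1ℤ + z) - 0ℤ) ≡ 1ℤ + (1ℤ + (1ℤ + (z + z - 0ℤ)))
  index = solve-∀
  step : ∀ z → choose (ℤ.suc z) 0 ≡ choose z 0
  step z = trans (cong (λ M → Φ M 0) (index z))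
    (trans (Φ-recurrence (ℤ.suc (z + z - 0ℤ)) 0) (ℤP.+-identityˡ _))

choose-zeroˡ : ∀ m → choose 0ℤ (suc m) ≡ 0ℤ
choose-zeroˡ m = trans (Φ-suc-neg m (suc m))
  (trans (cong (- sgn m *_) (fib-degree m (suc m) (ℕP.n≤1+n m))) (ℤP.*-zeroʳ (- sgn m)))

falling-pascal : ∀ z m → falling (ℤ.suc z) (suc m) ≡ falling z (suc m) + + suc m * falling z m
falling-pascal z zero    = lem z
  where
  lem : ∀ z → (1ℤ + z) * 1ℤ ≡ z * 1ℤ + 1ℤ * 1ℤ
  lem = solve-∀
falling-pascal z (suc m) = begin
  ℤ.suc z * falling (ℤ.suc z - 1ℤ) (suc m)
    ≡⟨ cong (λ y → ℤ.suc z * falling y (suc m)) (down z) ⟩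
  ℤ.suc z * falling z (suc m)
    ≡⟨ cong (λ x → ℤ.suc z * x) step ⟩
  ℤ.suc z * (f₁ + + suc m * f₀)
    ≡⟨ expand z f₁ f₀ (+ suc m) ⟩
  z * f₁ + (+ suc m * (z * f₀) + (f₁ + + suc m * f₀))
    ≡⟨ cong (λ x → z * f₁ + (+ suc m * (z * f₀) + x)) step ⟨
  z * f₁ + (+ suc m * falling z (suc m) + falling z (suc m))
    ≡⟨ collect (z * f₁) (falling z (suc m)) (+ suc m) ⟩
  falling z (suc (suc m)) + + suc (suc m) * falling z (suc m) ∎
  where
  open ≡-Reasoning
  f₀ f₁ : ℤ
  f₀ = falling (z - 1ℤ) m
  f₁ = falling (z - 1ℤ) (suc m)
  down : ∀ z → 1ℤ + z - 1ℤ ≡ z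
  down = solve-∀
  up : ∀ z → z ≡ 1ℤ + (z - 1ℤ)
  up = solve-∀
  step : falling z (suc m) ≡ f₁ + + suc m * f₀
  step = trans (cong (λ y → falling y (suc m)) (up z)) (falling-pascal (z - 1ℤ) m)
  expand : ∀ z f₁ f₀ c → (1ℤ + z) * (f₁ + c * f₀) ≡ z * f₁ + (c * (z * f₀) + (f₁ + c * f₀))
  expand = solve-∀
  collect : ∀ x y c → x + (c * y + y) ≡ x + (1ℤ + c) * y
  collect = solve-∀

-- For positive m both sides vanish at z = 0 and have the same difference in z, which determines
-- them on all of ℤ. The form multiplied by m! also shows that the division in `binomℤ` is exact.
choose-falling : ∀ m z → choose z m * + (m !) ≡ falling z m
choose-falling zero    z = trans (ℤP.*-identityʳ _) (choose-zeroʳ z)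
choose-falling (suc m) = ℤ-induction _
  (trans (cong (_* + (suc m !)) (choose-zeroˡ m)) (trans (ℤP.*-zeroˡ (+ (suc m !))) (sym (ℤP.*-zeroˡ (falling (0ℤ - 1ℤ) m)))))
  (λ z h → trans (step z) (trans (cong (_+ + suc m * falling z m) h) (sym (falling-pascal z m))))
  (λ z h → ∙-cancelʳ _ _ _ (trans (sym (step z)) (trans h (falling-pascal z m))))
  where
  open ≡-Reasoning
  lem : ∀ x y c d → (x + y) * (c * d) ≡ x * (c * d) + c * (y * d)
  lem = solve-∀
  step : ∀ z → choose (ℤ.suc z) (suc m) * + (suc m !) ≡ choose z (suc m) * + (suc m !) + + suc m * falling z m
  step z = begin
    choose (ℤ.suc z) (suc m) * + (suc m !)
      ≡⟨ cong₂ _*_ (choose-pascal z m) (ℤP.pos-* (suc m) (m !)) ⟩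
    (choose z (suc m) + choose z m) * (+ suc m * + (m !))
      ≡⟨ lem (choose z (suc m)) (choose z m) (+ suc m) (+ (m !)) ⟩
    choose z (suc m) * (+ suc m * + (m !)) + + suc m * (choose z m * + (m !))
      ≡⟨ cong₂ (λ x y → choose z (suc m) * x + + suc m * y)
           (sym (ℤP.pos-* (suc m) (m !))) (choose-falling m z) ⟩
    choose z (suc m) * + (suc m !) + + suc m * falling z m ∎

-- With q the quotient, (x - q) d is the remainder, so ∣x - q∣ d < d forces x = q.
x*d/ℕd≡x : ∀ x d .{{_ : ℕ.NonZero d}} → (x * + d) /ℕ d ≡ x
x*d/ℕd≡x x d = sym (ℤP.i-j≡0⇒i≡j x q (ℤP.∣i∣≡0⇒i≡0 (ℕP.n<1⇒n≡0 (ℕP.*-cancelʳ-< d ∣ x - q ∣ 1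
    (subst (_< 1 ℕ.* d) (sym (trans (sym (ℤP.abs-* (x - q) (+ d))) (cong ∣_∣ remainder)))
      (subst (r <_) (sym (ℕP.*-identityˡ d)) (n%ℕd<d (x * + d) d)))))))
  where
  q : ℤ
  q = (x * + d) /ℕ d
  r : ℕ
  r = (x * + d) %ℕ d
  lem : ∀ x q d → (x - q) * d ≡ x * d - q * d
  lem = solve-∀
  cancel : ∀ r y → r + y - y ≡ r
  cancel = solve-∀
  remainder : (x - q) * + d ≡ + r
  remainder = trans (lem x q (+ d))
    (trans (cong (_- q * + d) (a≡a%ℕn+[a/ℕn]*n (x * + d) d)) (cancel (+ r) (q * + d)))

binomℤ≡choose : ∀ z m → binomℤ z m ≡ choose z m
binomℤ≡choose z m = trans
  (cong (λ x → _/ℕ_ x (m !) {{m ℕP.!≢0}}) (sym (choose-falling m z)))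
  (x*d/ℕd≡x (choose z m) (m !) {{m ℕP.!≢0}})

-- The polynomials S_n: symmetry, parity and degree

weight : ℕ → ℕ → ℕ → ℤ
weight a n k = sgn k * (+ (n C k)) ^ a

expo : ℕ → ℕ → ℤ
expo n k = + 5 * + n - + 10 * + k

-- The coefficient of yᵐ in Σ_k weight a n k · v^(expo n k), which is a polynomial
-- in y = v - v⁻¹ because it is invariant under v ↦ - v⁻¹.
coeff : ℕ → ℕ → ℕ → ℤ
coeff a n m = ∑ (suc n) (λ k → weight a n k * Φ (ℤ.suc (expo n k)) m)

-- For z = 4n - 5k and m = 3n the index 2z - m + 1 equals 5n - 10k + 1, which is where the exponents
-- of S_n come from.
A≡coeff : ∀ a n → A a n ≡ coeff a n (3 ℕ.* n)
A≡coeff a n = trans (sumTo≡∑ n (λ k → weight a n k * binomℤ (top k) (3 ℕ.* n)))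
  (∑-cong (suc n) λ k _ → cong (weight a n k *_)
    (trans (binomℤ≡choose (top k) (3 ℕ.* n)) (cong (λ M → Φ (ℤ.suc M) (3 ℕ.* n)) (index k))))
  where
  top : ℕ → ℤ
  top k = + (4 ℕ.* n) - + (5 ℕ.* k)
  lem : ∀ x y → + 4 * x - + 5 * y + (+ 4 * x - + 5 * y) - + 3 * x ≡ + 5 * x - + 10 * y
  lem = solve-∀
  index : ∀ k → top k + top k - + (3 ℕ.* n) ≡ expo n k
  index k = trans
    (cong₂ (λ x y → x + x - y)
      (cong₂ _-_ (ℤP.pos-* 4 n) (ℤP.pos-* 5 k)) (ℤP.pos-* 3 n))
    (lem (+ n) (+ k))

weight-beyond : ∀ a .{{_ : ℕ.NonZero a}} n k → n < k → weight a n k ≡ 0ℤ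
weight-beyond (suc a) n k n<k = trans
  (cong (λ c → sgn k * (+ c * (+ (n C k)) ^ a)) (k>n⇒nCk≡0 n<k))
  (ℤP.*-zeroʳ (sgn k))

sgn-∸ : ∀ n k → k ≤ n → sgn (n ∸ k) ≡ sgn n * sgn k
sgn-∸ n k k≤n = begin
  sgn (n ∸ k)                       ≡⟨ ℤP.*-identityʳ _ ⟨
  sgn (n ∸ k) * 1ℤ                  ≡⟨ cong (sgn (n ∸ k) *_) (sgn² k) ⟨
  sgn (n ∸ k) * (sgn k * sgn k)     ≡⟨ ℤP.*-assoc (sgn (n ∸ k)) (sgn k) (sgn k) ⟨
  sgn (n ∸ k) * sgn k * sgn k       ≡⟨ cong (_* sgn k) (sgn-+ (n ∸ k) k) ⟨
  sgn (n ∸ k ℕ.+ k) * sgn k         ≡⟨ cong (λ x → sgn x * sgn k) (ℕP.m∸n+n≡m k≤n) ⟩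
  sgn n * sgn k                     ∎
  where open ≡-Reasoning

weight-reverse : ∀ a n k → k ≤ n → weight a n (n ∸ k) ≡ sgn n * weight a n k
weight-reverse a n k k≤n = trans
  (cong₂ (λ x c → x * (+ c) ^ a) (sgn-∸ n k k≤n) (sym (nCk≡nC[n∸k] k≤n)))
  (ℤP.*-assoc (sgn n) (sgn k) _)

expo-reverse : ∀ n k → k ≤ n → expo n (n ∸ k) ≡ - expo n k
expo-reverse n k k≤n = begin
  expo n (n ∸ k)                ≡⟨ cong (λ x → expo x (n ∸ k)) (ℕP.m∸n+n≡m k≤n) ⟨
  expo (n ∸ k ℕ.+ k) (n ∸ k)    ≡⟨ lem (+ (n ∸ k)) (+ k) ⟩
  - expo (n ∸ k ℕ.+ k) k        ≡⟨ cong (λ x → - expo x k) (ℕP.m∸n+n≡m k≤n) ⟩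
  - expo n k                    ∎
  where
  open ≡-Reasoning
  lem : ∀ x y → + 5 * (x + y) - + 10 * x ≡ - (+ 5 * (x + y) - + 10 * y)
  lem = solve-∀

sgn-suc : ∀ M → sgn ∣ ℤ.suc M ∣ ≡ - sgn ∣ M ∣
sgn-suc (+ n)        = refl
sgn-suc -[1+ zero ]  = refl
sgn-suc -[1+ suc n ] = sym (ℤP.neg-involutive _)

sgn-∣+∣ : ∀ n M → sgn ∣ + n + M ∣ ≡ sgn n * sgn ∣ M ∣
sgn-∣+∣ zero    M = trans (cong (sgn ∘ ∣_∣) (ℤP.+-identityˡ M)) (sym (ℤP.*-identityˡ _))
sgn-∣+∣ (suc n) M = begin
  sgn ∣ + suc n + M ∣       ≡⟨ cong (sgn ∘ ∣_∣) (ℤP.+-assoc 1ℤ (+ n) M) ⟩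
  sgn ∣ ℤ.suc (+ n + M) ∣   ≡⟨ sgn-suc (+ n + M) ⟩
  - sgn ∣ + n + M ∣         ≡⟨ cong -_ (sgn-∣+∣ n M) ⟩
  - (sgn n * sgn ∣ M ∣)     ≡⟨ ℤP.neg-distribˡ-* (sgn n) _ ⟩
  - sgn n * sgn ∣ M ∣       ∎
  where open ≡-Reasoning

sgn-double : ∀ n → sgn (n ℕ.+ n) ≡ 1ℤ
sgn-double n = trans (sgn-+ n n) (sgn² n)

sgn-expo : ∀ n k → sgn ∣ expo n k ∣ ≡ sgn n
sgn-expo n k = begin
  sgn ∣ expo n k ∣                                ≡⟨ ℤP.*-identityˡ _ ⟨
  1ℤ * sgn ∣ expo n k ∣                           ≡⟨ cong (_* sgn ∣ expo n k ∣) (sgn-double (5 ℕ.* k)) ⟨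
  sgn (5 ℕ.* k ℕ.+ 5 ℕ.* k) * sgn ∣ expo n k ∣    ≡⟨ sgn-∣+∣ (5 ℕ.* k ℕ.+ 5 ℕ.* k) (expo n k) ⟨
  sgn ∣ + (5 ℕ.* k ℕ.+ 5 ℕ.* k) + expo n k ∣      ≡⟨ cong (sgn ∘ ∣_∣) index ⟩
  sgn (2 ℕ.* n ℕ.+ 2 ℕ.* n ℕ.+ n)                 ≡⟨ sgn-+ (2 ℕ.* n ℕ.+ 2 ℕ.* n) n ⟩
  sgn (2 ℕ.* n ℕ.+ 2 ℕ.* n) * sgn n               ≡⟨ cong (_* sgn n) (sgn-double (2 ℕ.* n)) ⟩
  1ℤ * sgn n                                      ≡⟨ ℤP.*-identityˡ _ ⟩
  sgn n                                           ∎
  where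
  open ≡-Reasoning
  lem : ∀ x y → + 5 * y + + 5 * y + (+ 5 * x - + 10 * y) ≡ + 2 * x + + 2 * x + x
  lem = solve-∀
  index : + (5 ℕ.* k ℕ.+ 5 ℕ.* k) + expo n k ≡ + (2 ℕ.* n ℕ.+ 2 ℕ.* n ℕ.+ n)
  index = trans (cong (λ x → x + x + expo n k) (ℤP.pos-* 5 k))
    (trans (lem (+ n) (+ k)) (cong (λ x → x + x + + n) (sym (ℤP.pos-* 2 n))))

-- Writing S_n as P(y) v + Q(y), this is P = 0. Under k ↦ n - k the weight gains (-1)^n and the
-- exponent changes sign, which by `Φ-neg` costs -(-1)^n, so the sum is its own negative. As a
-- consequence Φ_{e+1} and Φ_{e-1} yield the same Q, and `coeff` may use the former.
antisymmetric-sum : ∀ a n m → ∑ (suc n) (λ k → weight a n k * Φ (expo n k) m) ≡ 0ℤ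
antisymmetric-sum a n m = x≡-x⇒x≡0 _ (begin
  ∑ (suc n) term                      ≡⟨ ∑-reverse n term ⟩
  ∑ (suc n) (λ k → term (n ∸ k))      ≡⟨ ∑-cong (suc n) (λ { k (s≤s k≤n) → flip k k≤n }) ⟩
  ∑ (suc n) (λ k → - 1ℤ * term k)     ≡⟨ ∑-*ˡ (suc n) (- 1ℤ) term ⟩
  - 1ℤ * ∑ (suc n) term               ≡⟨ ℤP.-1*i≡-i _ ⟩
  - ∑ (suc n) term                    ∎)
  where
  open ≡-Reasoning
  term : ℕ → ℤ
  term k = weight a n k * Φ (expo n k) m
  lem : ∀ s w x → s * w * (- s * x) ≡ s * s * (- 1ℤ * (w * x))
  lem = solve-∀
  flip : ∀ k → k ≤ n → term (n ∸ k) ≡ - 1ℤ * term k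
  flip k k≤n = begin
    weight a n (n ∸ k) * Φ (expo n (n ∸ k)) m
      ≡⟨ cong₂ (λ w M → w * Φ M m) (weight-reverse a n k k≤n) (expo-reverse n k k≤n) ⟩
    sgn n * weight a n k * Φ (- expo n k) m
      ≡⟨ cong (sgn n * weight a n k *_) (Φ-neg (expo n k) m) ⟩
    sgn n * weight a n k * (- sgn ∣ expo n k ∣ * Φ (expo n k) m)
      ≡⟨ cong (λ s → sgn n * weight a n k * (- s * Φ (expo n k) m)) (sgn-expo n k) ⟩
    sgn n * weight a n k * (- sgn n * Φ (expo n k) m)
      ≡⟨ lem (sgn n) (weight a n k) (Φ (expo n k) m) ⟩
    sgn n * sgn n * (- 1ℤ * term k)
      ≡⟨ cong (_* (- 1ℤ * term k)) (sgn² n) ⟩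
    1ℤ * (- 1ℤ * term k)
      ≡⟨ ℤP.*-identityˡ _ ⟩
    - 1ℤ * term k ∎

-- Φ_{e+1} carries only powers of y with the parity of e = 5n - 10k, which is that of n.
coeff-parity : ∀ a n m → sgn m ≡ - sgn n → coeff a n m ≡ 0ℤ
coeff-parity a n m opposite = ∑-zero (suc n) λ k _ → trans
  (cong (weight a n k *_) (x≡-x⇒x≡0 _ (trans (Φ-parity (ℤ.suc (expo n k)) m) (trans
    (cong (_* Φ (ℤ.suc (expo n k)) m) (minus k)) (ℤP.-1*i≡-i _)))))
  (ℤP.*-zeroʳ (weight a n k))
  where
  lem : ∀ x → - x * - x ≡ x * x
  lem = solve-∀
  minus : ∀ k → - (sgn ∣ ℤ.suc (expo n k) ∣ * sgn m) ≡ - 1ℤ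
  minus k = cong -_ (trans
    (cong₂ _*_ (trans (sgn-suc (expo n k)) (cong -_ (sgn-expo n k))) opposite)
    (trans (lem (sgn n)) (sgn² n)))

∣m-n∣-bound : ∀ m n b → m ≤ b → n ≤ m ℕ.+ b → ∣ + m - + n ∣ ≤ b
∣m-n∣-bound m n b m≤b n≤m+b with ℕP.≤-total m n
... | inj₁ m≤n = ℕP.≤-trans
  (ℕP.≤-reflexive (trans (cong ∣_∣ (ℤP.m-n≡m⊖n m n)) (ℤP.∣⊖∣-≤ m≤n)))
  (ℕP.m≤n+o⇒m∸n≤o n m n≤m+b)
... | inj₂ n≤m = ℕP.≤-trans
  (ℕP.≤-reflexive (trans (ℤP.∣i-j∣≡∣j-i∣ (+ m) (+ n)) (trans (cong ∣_∣ (ℤP.m-n≡m⊖n n m)) (ℤP.∣⊖∣-≤ n≤m))))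
  (ℕP.≤-trans (ℕP.m∸n≤m m n) m≤b)

coeff-degree : ∀ a n m → suc (5 ℕ.* n) ≤ m → coeff a n m ≡ 0ℤ
coeff-degree a n m 5n<m = ∑-zero (suc n) {term} λ { k (s≤s k≤n) → trans
  (cong (weight a n k *_) (Φ-degree (ℤ.suc (expo n k)) m (ℕP.≤-trans (bound k k≤n) 5n<m)))
  (ℤP.*-zeroʳ (weight a n k)) }
  where
  term : ℕ → ℤ
  term k = weight a n k * Φ (ℤ.suc (expo n k)) m
  10n : ∀ n → 10 ℕ.* n ≡ 5 ℕ.* n ℕ.+ 5 ℕ.* n
  10n = ℕR.solve-∀
  bound : ∀ k → k ≤ n → ∣ ℤ.suc (expo n k) ∣ ≤ suc (5 ℕ.* n)
  bound k k≤n = ℕP.≤-trans (ℤP.∣i+j∣≤∣i∣+∣j∣ 1ℤ (expo n k)) (s≤s (subst (λ x → ∣ x ∣ ≤ 5 ℕ.* n)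
    (cong₂ _-_ (ℤP.pos-* 5 n) (ℤP.pos-* 10 k))
    (∣m-n∣-bound (5 ℕ.* n) (10 ℕ.* k) (5 ℕ.* n) ℕP.≤-refl
      (subst (10 ℕ.* k ≤_) (10n n) (ℕP.*-monoʳ-≤ 10 k≤n)))))

-- Expanding powers of W when W - W⁻¹ = Y

∑-bilinear : ∀ n N (w : ℕ → ℤ) (F : ℕ → ℕ → ℤ) (y : ℕ → ℤ) →
  ∑ n (λ k → w k * ∑ N (λ i → F k i * y i)) ≡ ∑ N (λ i → ∑ n (λ k → w k * F k i) * y i)
∑-bilinear n N w F y = begin
  ∑ n (λ k → w k * ∑ N (λ i → F k i * y i))
    ≡⟨ ∑-cong n (λ k _ → ∑-*ˡ N (w k) (λ i → F k i * y i)) ⟨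
  ∑ n (λ k → ∑ N (λ i → w k * (F k i * y i)))
    ≡⟨ ∑-swap n N (λ k i → w k * (F k i * y i)) ⟩
  ∑ N (λ i → ∑ n (λ k → w k * (F k i * y i)))
    ≡⟨ ∑-cong N (λ i _ → trans (∑-cong n λ k _ → lem (w k) (F k i) (y i))
         (trans (∑-*ˡ n (y i) (λ k → w k * F k i)) (ℤP.*-comm (y i) _))) ⟩
  ∑ N (λ i → ∑ n (λ k → w k * F k i) * y i) ∎
  where
  open ≡-Reasoning
  lem : ∀ w f y → w * (f * y) ≡ y * (w * f)
  lem = solve-∀

module _ (N : ℕ) (y : ℕ → ℤ) (y≡0 : ∀ i → N ≤ i → y i ≡ 0ℤ) where

  -- With `y i` read as L(Yⁱ) for a linear functional L, this is L(f(Y) Yʲ). It is a finite sum for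
  -- every f because L kills Yⁱ from i = N on.
  pairing : (ℕ → ℤ) → ℕ → ℤ
  pairing f j = ∑ N (λ i → f i * y (i ℕ.+ j))

  pairing-shift : ∀ f j → pairing (shift 1 f) j ≡ pairing f (suc j)
  pairing-shift f j = go N y≡0
    where
    open ≡-Reasoning
    go : ∀ N → (∀ i → N ≤ i → y i ≡ 0ℤ) →
      ∑ N (λ i → shift 1 f i * y (i ℕ.+ j)) ≡ ∑ N (λ i → f i * y (i ℕ.+ suc j))
    go zero    _   = refl
    go (suc N) y≡0 = begin
      0ℤ * y j + ∑ N (λ i → f i * y (suc i ℕ.+ j))
        ≡⟨ ℤP.+-comm (0ℤ * y j) (∑ N (λ i → f i * y (suc i ℕ.+ j))) ⟩
      ∑ N (λ i → f i * y (suc i ℕ.+ j)) + 0ℤ * y j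
        ≡⟨ cong₂ _+_ (∑-cong N λ i _ → cong (λ x → f i * y x) (sym (ℕP.+-suc i j)))
             (trans (ℤP.*-zeroˡ (y j)) (sym (trans
               (cong (f N *_) (y≡0 (N ℕ.+ suc j) (ℕP.≤-trans (ℕP.m≤n+m (suc N) j) (ℕP.≤-reflexive (swap j N)))))
               (ℤP.*-zeroʳ (f N))))) ⟩
      ∑ N (λ i → f i * y (i ℕ.+ suc j)) + f N * y (N ℕ.+ suc j)
        ≡⟨ ∑-last N (λ i → f i * y (i ℕ.+ suc j)) ⟨
      ∑ (suc N) (λ i → f i * y (i ℕ.+ suc j)) ∎
      where
      swap : ∀ j N → j ℕ.+ suc N ≡ N ℕ.+ suc j
      swap = ℕR.solve-∀

  pairing-recurrence : ∀ {f g h} → (∀ i → f i ≡ shift 1 g i + h i) → ∀ j → pairing f j ≡ pairing g (suc j) + pairing h j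
  pairing-recurrence {f} {g} {h} eq j = begin
    pairing f j
      ≡⟨ ∑-cong N (λ i _ → trans (cong (_* y (i ℕ.+ j)) (eq i)) (ℤP.*-distribʳ-+ (y (i ℕ.+ j)) (shift 1 g i) (h i))) ⟩
    ∑ N (λ i → shift 1 g i * y (i ℕ.+ j) + h i * y (i ℕ.+ j))
      ≡⟨ ∑-+ N (λ i → shift 1 g i * y (i ℕ.+ j)) (λ i → h i * y (i ℕ.+ j)) ⟩
    pairing (shift 1 g) j + pairing h j
      ≡⟨ cong (_+ pairing h j) (pairing-shift g j) ⟩
    pairing g (suc j) + pairing h j ∎
    where open ≡-Reasoning

-- x M j plays the role of a linear functional applied to W^M Y^j, where W - W⁻¹ = Y modulo d.
module FibonacciExpansion (d : ℤ) (N : ℕ) (x : ℤ → ℕ → ℤ)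
  (x-zero : ∀ M j → suc N ≤ j → x M j ≡ 0ℤ)
  (x-recurrence : ∀ M j → Modulo._≈_ d (x (ℤ.suc (ℤ.suc M)) j) (x (ℤ.suc M) (suc j) + x M j)) where

  open Modulo d

  -- The functional applied to W^(M+1) Yʲ = (Φ_{M+1}(Y) W + Φ_M(Y)) Yʲ: `x 1ℤ` carries the factor W
  -- and `x 0ℤ` the factor 1.
  expansion : ℤ → ℕ → ℤ
  expansion M j = pairing (suc N) (x 1ℤ) (x-zero 1ℤ) (Φ (ℤ.suc M)) j + pairing (suc N) (x 0ℤ) (x-zero 0ℤ) (Φ M) j

  expansion-recurrence : ∀ M j →
    expansion (ℤ.suc (ℤ.suc M)) j ≡ expansion (ℤ.suc M) (suc j) + expansion M j
  expansion-recurrence M j = trans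
    (cong₂ _+_ (pairing-recurrence (suc N) (x 1ℤ) (x-zero 1ℤ) (Φ-recurrence (ℤ.suc M)) j)
               (pairing-recurrence (suc N) (x 0ℤ) (x-zero 0ℤ) (Φ-recurrence M) j))
    (lem (pairing (suc N) (x 1ℤ) (x-zero 1ℤ) (Φ (ℤ.suc (ℤ.suc M))) (suc j)) _ _ _)
    where
    lem : ∀ a b c d → a + b + (c + d) ≡ a + c + (b + d)
    lem = solve-∀

  Expands : ℤ → Set
  Expands M = ∀ j → x (ℤ.suc M) j ≈ expansion M j

  up : ∀ M → Expands M → Expands (ℤ.suc M) → Expands (ℤ.suc (ℤ.suc M))
  up M h₀ h₁ j = begin
    x (ℤ.suc (ℤ.suc (ℤ.suc M))) j                     ≈⟨ x-recurrence (ℤ.suc M) j ⟩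
    x (ℤ.suc (ℤ.suc M)) (suc j) + x (ℤ.suc M) j       ≈⟨ +-cong (h₁ (suc j)) (h₀ j) ⟩
    expansion (ℤ.suc M) (suc j) + expansion M j       ≡⟨ expansion-recurrence M j ⟨
    expansion (ℤ.suc (ℤ.suc M)) j                     ∎
    where open ≈-Reasoning

  down : ∀ M → Expands (ℤ.suc M) → Expands (ℤ.suc (ℤ.suc M)) → Expands M
  down M h₁ h₂ j = begin
    x (ℤ.suc M) j
      ≡⟨ add-sub (x (ℤ.suc (ℤ.suc M)) (suc j)) (x (ℤ.suc M) j) ⟩
    (x (ℤ.suc (ℤ.suc M)) (suc j) + x (ℤ.suc M) j) - x (ℤ.suc (ℤ.suc M)) (suc j)
      ≈⟨ +-cong (≈-trans (≈-sym (x-recurrence (ℤ.suc M) j)) (h₂ j)) (neg-cong (h₁ (suc j))) ⟩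
    expansion (ℤ.suc (ℤ.suc M)) j - expansion (ℤ.suc M) (suc j)
      ≡⟨ cong (_- expansion (ℤ.suc M) (suc j)) (expansion-recurrence M j) ⟩
    expansion (ℤ.suc M) (suc j) + expansion M j - expansion (ℤ.suc M) (suc j)
      ≡⟨ add-sub (expansion (ℤ.suc M) (suc j)) (expansion M j) ⟨
    expansion M j ∎
    where
    open ≈-Reasoning
    add-sub : ∀ a b → b ≡ a + b - a
    add-sub = solve-∀

  pairing-one : ∀ M f j → f 0 ≡ 1ℤ → (∀ i → f (suc i) ≡ 0ℤ) → pairing (suc N) (x M) (x-zero M) f j ≡ x M j
  pairing-one M f j f0 f1 = trans
    (cong₂ _+_ (trans (cong (_* x M j) f0) (ℤP.*-identityˡ _))
      (∑-zero N λ i _ → trans (cong (_* x M (suc i ℕ.+ j)) (f1 i)) (ℤP.*-zeroˡ (x M (suc i ℕ.+ j)))))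
    (ℤP.+-identityʳ _)

  pairing-zero : ∀ M f j → (∀ i → f i ≡ 0ℤ) → pairing (suc N) (x M) (x-zero M) f j ≡ 0ℤ
  pairing-zero M f j f≡0 = ∑-zero (suc N) λ i _ →
    trans (cong (_* x M (i ℕ.+ j)) (f≡0 i)) (ℤP.*-zeroˡ (x M (i ℕ.+ j)))

  expands-0 : Expands 0ℤ
  expands-0 j = ≈-reflexive (sym (trans
    (cong₂ _+_ (pairing-one 1ℤ (Φ 1ℤ) j refl (λ _ → refl)) (pairing-zero 0ℤ (Φ 0ℤ) j (λ _ → refl)))
    (ℤP.+-identityʳ _)))

  expands-neg1 : Expands -[1+ 0 ]
  expands-neg1 j = ≈-reflexive (sym (trans
    (cong₂ _+_ (pairing-zero 1ℤ (Φ 0ℤ) j (λ _ → refl)) (pairing-one 0ℤ (Φ -[1+ 0 ]) j refl (λ _ → refl)))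
    (ℤP.+-identityˡ _)))

  -- The recurrence has order two, so the induction over ℤ carries two neighbouring exponents.
  expands : ∀ M → Expands M
  expands M = proj₁ (ℤ-induction (λ M → Expands M × Expands (ℤ.suc M))
    (expands-0 , up -[1+ 0 ] expands-neg1 expands-0)
    (λ M (h₀ , h₁) → h₁ , up M h₀ h₁)
    (λ M (h₁ , h₂) → down M h₁ h₂ , h₁) M)

  -- The W-component of the expansion cancels because of the symmetry W ↦ - W⁻¹.
  palindromic-expansion : ∀ a n →
    ∑ (suc n) (λ k → weight a n k * x (ℤ.suc (expo n k)) 0) ≈ ∑ (suc N) (λ i → coeff a n i * x 1ℤ i)
  palindromic-expansion a n = begin
    ∑ (suc n) (λ k → w k * x (ℤ.suc (expo n k)) 0)
      ≈⟨ ∑-≈ (suc n) (λ k _ → *-cong (≈-refl {w k}) (expands (expo n k) 0)) ⟩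
    ∑ (suc n) (λ k → w k * (X₁ k + X₀ k))
      ≡⟨ ∑-cong (suc n) (λ k _ → ℤP.*-distribˡ-+ (w k) (X₁ k) (X₀ k)) ⟩
    ∑ (suc n) (λ k → w k * X₁ k + w k * X₀ k)
      ≡⟨ ∑-+ (suc n) (λ k → w k * X₁ k) (λ k → w k * X₀ k) ⟩
    ∑ (suc n) (λ k → w k * X₁ k) + ∑ (suc n) (λ k → w k * X₀ k)
      ≡⟨ cong₂ _+_
           (∑-bilinear (suc n) (suc N) w (λ k → Φ (ℤ.suc (expo n k))) (λ i → x 1ℤ (i ℕ.+ 0)))
           (trans (∑-bilinear (suc n) (suc N) w (λ k → Φ (expo n k)) (λ i → x 0ℤ (i ℕ.+ 0)))
             (∑-zero (suc N) λ i _ → trans (cong (_* x 0ℤ (i ℕ.+ 0)) (antisymmetric-sum a n i))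
               (ℤP.*-zeroˡ (x 0ℤ (i ℕ.+ 0))))) ⟩
    ∑ (suc N) (λ i → coeff a n i * x 1ℤ (i ℕ.+ 0)) + 0ℤ
      ≡⟨ ℤP.+-identityʳ _ ⟩
    ∑ (suc N) (λ i → coeff a n i * x 1ℤ (i ℕ.+ 0))
      ≡⟨ ∑-cong (suc N) (λ i _ → cong (λ j → coeff a n i * x 1ℤ j) (ℕP.+-identityʳ i)) ⟩
    ∑ (suc N) (λ i → coeff a n i * x 1ℤ i) ∎
    where
    open ≈-Reasoning
    w X₁ X₀ : ℕ → ℤ
    w = weight a n
    X₁ k = pairing (suc N) (x 1ℤ) (x-zero 1ℤ) (Φ (ℤ.suc (expo n k))) 0
    X₀ k = pairing (suc N) (x 0ℤ) (x-zero 0ℤ) (Φ (expo n k)) 0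

-- Finite differences

Δ : (ℕ → ℤ) → ℕ → ℤ
Δ f k = f (suc k) - f k

Δ^ : ℕ → (ℕ → ℤ) → ℕ → ℤ
Δ^ zero    f = f
Δ^ (suc i) f = Δ^ i (Δ f)

Δ^-suc : ∀ i f k → Δ^ i f (suc k) ≡ Δ^ (suc i) f k + Δ^ i f k
Δ^-suc zero    f k = lem (f (suc k)) (f k)
  where
  lem : ∀ x y → x ≡ x - y + y
  lem = solve-∀
Δ^-suc (suc i) f k = Δ^-suc i (Δ f) k

-- Polynomial sequences of degree less than d.
Deg : ℕ → (ℕ → ℤ) → Set
Deg zero    f = ∀ k → f k ≡ 0ℤ
Deg (suc d) f = Deg d (Δ f)

Deg-cong : ∀ d {f g} → (∀ k → f k ≡ g k) → Deg d f → Deg d g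
Deg-cong zero    eq h k = trans (sym (eq k)) (h k)
Deg-cong (suc d) eq h   = Deg-cong d (λ k → cong₂ _-_ (eq (suc k)) (eq k)) h

Deg⇒Δ^≡0 : ∀ d {f} → Deg d f → ∀ k → Δ^ d f k ≡ 0ℤ
Deg⇒Δ^≡0 zero    h = h
Deg⇒Δ^≡0 (suc d) h = Deg⇒Δ^≡0 d h

Deg-suc : ∀ d {f} → Deg d f → Deg (suc d) f
Deg-suc zero    h k = cong₂ _-_ (h (suc k)) (h k)
Deg-suc (suc d) h   = Deg-suc d h

Deg-mono : ∀ {d e f} → d ≤ e → Deg d f → Deg e f
Deg-mono {d} {e} {f} d≤e h = subst (λ c → Deg c f) (ℕP.m∸n+n≡m d≤e) (go (e ∸ d))
  where
  go : ∀ c → Deg (c ℕ.+ d) f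
  go zero    = h
  go (suc c) = Deg-suc (c ℕ.+ d) (go c)

Deg-zero : ∀ d {f} → (∀ k → f k ≡ 0ℤ) → Deg d f
Deg-zero d = Deg-mono {0} {d} z≤n

Deg-+ : ∀ d {f g} → Deg d f → Deg d g → Deg d (λ k → f k + g k)
Deg-+ zero            h h′ k = cong₂ _+_ (h k) (h′ k)
Deg-+ (suc d) {f} {g} h h′   = Deg-cong d (λ k → lem (f (suc k)) (f k) (g (suc k)) (g k)) (Deg-+ d h h′)
  where
  lem : ∀ a b c d → a - b + (c - d) ≡ a + c - (b + d)
  lem = solve-∀

Deg-neg : ∀ d {f} → Deg d f → Deg d (λ k → - f k)
Deg-neg zero        h k = cong -_ (h k)
Deg-neg (suc d) {f} h   = Deg-cong d (λ k → lem (f (suc k)) (f k)) (Deg-neg d h)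
  where
  lem : ∀ a b → - (a - b) ≡ - a - - b
  lem = solve-∀

Deg-∑ : ∀ d n {F : ℕ → ℕ → ℤ} → (∀ j → Deg d (F j)) → Deg d (λ k → ∑ n (λ j → F j k))
Deg-∑ d zero    h = Deg-zero d λ _ → refl
Deg-∑ d (suc n) h = Deg-+ d (h 0) (Deg-∑ d n (h ∘ suc))

Deg-∘suc : ∀ d {f} → Deg d f → Deg d (f ∘ suc)
Deg-∘suc zero    h = h ∘ suc
Deg-∘suc (suc d) h = Deg-∘suc d h

-- Leibniz' rule Δ(fg)(k) = Δf(k) g(k+1) + f(k) Δg(k) lowers one of the degrees in each term.
-- `Deg (suc d)` means degree at most d, so the bounds simply add.
Deg-* : ∀ d e {f g} → Deg (suc d) f → Deg (suc e) g → Deg (suc (d ℕ.+ e)) (λ k → f k * g k)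
Deg-* d e {f} {g} hf hg = Deg-cong (d ℕ.+ e) (λ k → lem (f (suc k)) (f k) (g (suc k)) (g k))
  (Deg-+ (d ℕ.+ e) (left d hf) (right e hg))
  where
  lem : ∀ a b c d → (a - b) * c + b * (c - d) ≡ a * c - b * d
  lem = solve-∀
  left : ∀ d → Deg (suc d) f → Deg (d ℕ.+ e) (λ k → Δ f k * g (suc k))
  left zero     hf = Deg-zero e λ k → trans (cong (_* g (suc k)) (hf k)) (ℤP.*-zeroˡ (g (suc k)))
  left (suc d′) hf = Deg-* d′ e {Δ f} {g ∘ suc} hf (Deg-∘suc (suc e) {g} hg)
  right : ∀ e → Deg (suc e) g → Deg (d ℕ.+ e) (λ k → f k * Δ g k)
  right zero     hg = Deg-zero (d ℕ.+ 0) λ k → trans (cong (f k *_) (hg k)) (ℤP.*-zeroʳ (f k))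
  right (suc e′) hg = subst (λ c → Deg c (λ k → f k * Δ g k)) (sym (ℕP.+-suc d e′)) (Deg-* d e′ {f} {Δ g} hf hg)

Deg-C : ∀ m → Deg (suc m) (λ k → + ((m ℕ.+ k) C m))
Deg-C zero    k = cong₂ (λ x y → + x - + y) (C-zero (suc k)) (C-zero k)
Deg-C (suc m)   = Deg-cong (suc m) (λ k → sym (difference k)) (Deg-∘suc (suc m) {λ k → + ((m ℕ.+ k) C m)} (Deg-C m))
  where
  open ≡-Reasoning
  lem : ∀ x y → x + y - y ≡ x
  lem = solve-∀
  difference : ∀ k → + ((suc m ℕ.+ suc k) C suc m) - + ((suc m ℕ.+ k) C suc m) ≡ + ((m ℕ.+ suc k) C m)
  difference k = begin
    + ((suc m ℕ.+ suc k) C suc m) - + ((suc m ℕ.+ k) C suc m)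
      ≡⟨ cong₂ (λ x y → x - + (y C suc m)) (pascal (m ℕ.+ suc k) m) (sym (ℕP.+-suc m k)) ⟩
    + ((m ℕ.+ suc k) C m) + + ((m ℕ.+ suc k) C suc m) - + ((m ℕ.+ suc k) C suc m)
      ≡⟨ lem (+ ((m ℕ.+ suc k) C m)) (+ ((m ℕ.+ suc k) C suc m)) ⟩
    + ((m ℕ.+ suc k) C m) ∎

-- Pascal's rule telescoped r times. It is meant for r = 5, since the upper entry 4n - 5k drops by 5
-- at each step of k.
choose-drop : ∀ r z i → choose (z - + r) (suc i) - choose z (suc i) ≡ - ∑ r (λ j → choose (z - + suc j) i)
choose-drop zero    z i = trans (cong (λ y → choose y (suc i) - choose z (suc i)) (ℤP.+-identityʳ z)) (ℤP.+-inverseʳ (choose z (suc i)))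
choose-drop (suc r) z i = begin
  choose (z - + suc r) (suc i) - choose z (suc i)
    ≡⟨ regroup (choose (z - + suc r) (suc i)) (choose (z - + suc r) i) (choose z (suc i)) ⟩
  choose (z - + suc r) (suc i) + choose (z - + suc r) i - choose z (suc i) - choose (z - + suc r) i
    ≡⟨ cong (λ x → x - choose z (suc i) - choose (z - + suc r) i)
         (trans (sym (choose-pascal (z - + suc r) i)) (cong (λ y → choose y (suc i)) (up z (+ r)))) ⟩
  choose (z - + r) (suc i) - choose z (suc i) - choose (z - + suc r) i
    ≡⟨ cong (_- choose (z - + suc r) i) (choose-drop r z i) ⟩
  - ∑ r g - g r
    ≡⟨ ℤP.neg-distrib-+ (∑ r g) (g r) ⟨
  - (∑ r g + g r)
    ≡⟨ cong -_ (∑-last r g) ⟨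
  - ∑ (suc r) g ∎
  where
  open ≡-Reasoning
  g : ℕ → ℤ
  g j = choose (z - + suc j) i
  up : ∀ z r → 1ℤ + (z - (1ℤ + r)) ≡ z - r
  up = solve-∀
  regroup : ∀ a b c → a - c ≡ a + b - c - b
  regroup = solve-∀

Deg-choose : ∀ i c → Deg (suc i) (λ k → choose (c - + 5 * + k) i)
Deg-choose zero    c k = cong₂ _-_ (choose-zeroʳ (c - + 5 * + suc k)) (choose-zeroʳ (c - + 5 * + k))
Deg-choose (suc i) c   = Deg-cong (suc i) (λ k → sym (difference k))
  (Deg-neg (suc i) {λ k → ∑ 5 (λ j → lower j k)} (Deg-∑ (suc i) 5 {lower} λ j → Deg-choose i (c - + suc j)))
  where
  open ≡-Reasoning
  lower : ℕ → ℕ → ℤ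
  lower j k = choose (c - + suc j - + 5 * + k) i
  next : ∀ c k → c - + 5 * (1ℤ + k) ≡ c - + 5 * k - + 5
  next = solve-∀
  commute : ∀ c k j → c - + 5 * k - j ≡ c - j - + 5 * k
  commute = solve-∀
  difference : ∀ k → choose (c - + 5 * + suc k) (suc i) - choose (c - + 5 * + k) (suc i)
    ≡ - ∑ 5 (λ j → lower j k)
  difference k = begin
    choose (c - + 5 * + suc k) (suc i) - choose (c - + 5 * + k) (suc i)
      ≡⟨ cong (λ z → choose z (suc i) - choose (c - + 5 * + k) (suc i)) (next c (+ k)) ⟩
    choose (c - + 5 * + k - + 5) (suc i) - choose (c - + 5 * + k) (suc i)
      ≡⟨ choose-drop 5 (c - + 5 * + k) i ⟩
    - ∑ 5 (λ j → choose (c - + 5 * + k - + suc j) i)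
      ≡⟨ cong -_ (∑-cong 5 λ j _ → cong (λ z → choose z i) (commute c (+ k) (+ suc j))) ⟩
    - ∑ 5 (λ j → lower j k) ∎

-- The factorisation of S_n modulo p

^-distribʳ-* : ∀ x y a → (x * y) ^ a ≡ x ^ a * y ^ a
^-distribʳ-* x y zero    = refl
^-distribʳ-* x y (suc a) = trans (cong (x * y *_) (^-distribʳ-* x y a)) (lem x y (x ^ a) (y ^ a))
  where
  lem : ∀ x y u v → x * y * (u * v) ≡ x * u * (y * v)
  lem = solve-∀

module LucasStep (p : ℕ) (pr : Prime p) where

  open Frobenius p pr public

  weight-lucas : ∀ a {n₀ k₀} → n₀ < p → k₀ < p → ∀ n₁ k₁ →
    weight a (n₀ ℕ.+ p ℕ.* n₁) (k₀ ℕ.+ p ℕ.* k₁) ≈ weight a n₀ k₀ * weight a n₁ k₁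
  weight-lucas a {n₀} {k₀} n₀<p k₀<p n₁ k₁ = begin
    sgn (k₀ ℕ.+ p ℕ.* k₁) * (+ ((n₀ ℕ.+ p ℕ.* n₁) C (k₀ ℕ.+ p ℕ.* k₁))) ^ a
      ≈⟨ *-cong
           (≈-trans (≈-reflexive (sgn-+ k₀ (p ℕ.* k₁))) (*-cong (≈-refl {sgn k₀}) (sgn-p* k₁)))
           (^-cong a (lucas n₀<p k₀<p n₁ k₁)) ⟩
    sgn k₀ * sgn k₁ * (+ (n₀ C k₀) * + (n₁ C k₁)) ^ a
      ≡⟨ cong (sgn k₀ * sgn k₁ *_) (^-distribʳ-* (+ (n₀ C k₀)) (+ (n₁ C k₁)) a) ⟩
    sgn k₀ * sgn k₁ * ((+ (n₀ C k₀)) ^ a * (+ (n₁ C k₁)) ^ a)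
      ≡⟨ lem (sgn k₀) (sgn k₁) ((+ (n₀ C k₀)) ^ a) ((+ (n₁ C k₁)) ^ a) ⟩
    weight a n₀ k₀ * weight a n₁ k₁ ∎
    where
    open ≈-Reasoning
    lem : ∀ s t x y → s * t * (x * y) ≡ s * x * (t * y)
    lem = solve-∀

  -- The operator identity v = y + v⁻¹ raised to the power p, with T = y and S = v⁻¹. In `G a b i`
  -- the arguments count factors v, v⁻¹ and y.
  Φ-frobenius : ∀ c M j m → shift (p ℕ.* j) (Φ (c + + p * ℤ.suc (ℤ.suc M))) m
    ≈ shift (p ℕ.* suc j) (Φ (c + + p * ℤ.suc M)) m + shift (p ℕ.* j) (Φ (c + + p * M)) m
  Φ-frobenius c M j m = begin
    shift (p ℕ.* j) (Φ (c + + p * ℤ.suc (ℤ.suc M))) m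
      ≡⟨ cong₂ (λ i K → shift i (Φ K) m) (sym (ℕP.+-identityʳ (p ℕ.* j))) (top c (+ p) M) ⟩
    G p 0 0
      ≈⟨ frobenius G step ⟩
    G 0 p 0 + G 0 0 p
      ≡⟨ ℤP.+-comm (G 0 p 0) (G 0 0 p) ⟩
    G 0 0 p + G 0 p 0
      ≡⟨ cong₂ _+_
           (cong₂ (λ i K → shift i (Φ K) m) (trans (ℕP.+-comm (p ℕ.* j) p) (sym (ℕP.*-suc p j))) (middle c (+ p) M))
           (cong₂ (λ i K → shift i (Φ K) m) (ℕP.+-identityʳ (p ℕ.* j)) (bottom c (+ p) M)) ⟩
    shift (p ℕ.* suc j) (Φ (c + + p * ℤ.suc M)) m + shift (p ℕ.* j) (Φ (c + + p * M)) m ∎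
    where
    open ≈-Reasoning
    E : ℤ
    E = c + + p * ℤ.suc M
    G : ℕ → ℕ → ℕ → ℤ
    G a b i = shift (p ℕ.* j ℕ.+ i) (Φ (E + + a - + b)) m
    top : ∀ c p M → c + p * (1ℤ + (1ℤ + M)) ≡ c + p * (1ℤ + M) + p - 0ℤ
    top = solve-∀
    middle : ∀ c p M → c + p * (1ℤ + M) + 0ℤ - 0ℤ ≡ c + p * (1ℤ + M)
    middle = solve-∀
    bottom : ∀ c p M → c + p * (1ℤ + M) + 0ℤ - p ≡ c + p * M
    bottom = solve-∀
    two-up : ∀ E a b → E + (1ℤ + a) - b ≡ 1ℤ + (1ℤ + (E + a - (1ℤ + b)))
    two-up = solve-∀
    one-up : ∀ E a b → 1ℤ + (E + a - (1ℤ + b)) ≡ E + a - b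
    one-up = solve-∀
    step : ∀ a b i → G (suc a) b i ≡ G a b (suc i) + G a (suc b) i
    step a b i = trans
      (cong (λ K → shift (p ℕ.* j ℕ.+ i) (Φ K) m) (two-up E (+ a) (+ b)))
      (trans (shift-linear (p ℕ.* j ℕ.+ i) (Φ-recurrence (E + + a - + suc b)) m)
        (cong (_+ G a (suc b) i)
          (cong₂ (λ l K → shift l (Φ K) m) (sym (ℕP.+-suc (p ℕ.* j) i)) (one-up E (+ a) (+ b)))))

  -- Evaluation of S_n at W = v^p and Y = y^p, acting on Φ_c. The base index c - p makes W
  -- correspond to Φ_c and W^(e+1) to Φ_{c+pe}.
  inner-sum : ∀ a n c m →
    ∑ (suc n) (λ k → weight a n k * Φ (c + + p * expo n k) m)
      ≈ ∑ (suc m) (λ i → coeff a n i * shift (p ℕ.* i) (Φ c) m)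
  inner-sum a n c m = begin
    ∑ (suc n) (λ k → weight a n k * Φ (c + + p * expo n k) m)
      ≡⟨ ∑-cong (suc n) (λ k _ → cong (weight a n k *_)
           (cong₂ (λ i K → shift i (Φ K) m) (sym (ℕP.*-zeroʳ p)) (re-base c (+ p) (expo n k)))) ⟩
    ∑ (suc n) (λ k → weight a n k * x (ℤ.suc (expo n k)) 0)
      ≈⟨ FibonacciExpansion.palindromic-expansion (+ p) m x
           -- The bound N = m suffices: y^(pj) has exponent at least j, so it cannot reach y^m once
           -- j > m.
           (λ M j m<j → shift-< (p ℕ.* j) (Φ (c - + p + + p * M)) m
             (ℕP.<-≤-trans m<j (ℕP.m≤n*m j p {{ℕ.>-nonZero 0<p}})))
           (λ M j → Φ-frobenius (c - + p) M j m) a n ⟩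
    ∑ (suc m) (λ i → coeff a n i * x 1ℤ i)
      ≡⟨ ∑-cong (suc m) (λ i _ → cong (λ K → coeff a n i * shift (p ℕ.* i) (Φ K) m) (base c (+ p))) ⟩
    ∑ (suc m) (λ i → coeff a n i * shift (p ℕ.* i) (Φ c) m) ∎
    where
    open ≈-Reasoning
    x : ℤ → ℕ → ℤ
    x M j = shift (p ℕ.* j) (Φ (c - + p + + p * M)) m
    re-base : ∀ c p e → c + p * e ≡ c - p + p * (1ℤ + e)
    re-base = solve-∀
    base : ∀ c p → c - p + p * 1ℤ ≡ c
    base = solve-∀

  module _ (a : ℕ) .{{_ : ℕ.NonZero a}} where

    weight-sum : ∀ n b (f : ℕ → ℤ) → n < b → ∑ b (λ k → weight a n k * f k) ≡ ∑ (suc n) (λ k → weight a n k * f k)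
    weight-sum n b f n<b = ∑-extend (suc n) b (λ k → weight a n k * f k)
      (λ k n<k → trans (cong (_* f k) (weight-beyond a n k n<k)) (ℤP.*-zeroˡ (f k))) n<b

    -- For k = k₀ + p k₁ the weight factors by Lucas' theorem and the exponent is e₀ + p e₁. The sum
    -- over k₁ is `inner-sum` and produces S_{n₁}(y^p); the sum over k₀ produces S_{n₀}(y).
    coeff-lucas : ∀ {n₀} → n₀ < p → ∀ n₁ m →
      coeff a (n₀ ℕ.+ p ℕ.* n₁) m ≈ ∑ (suc m) (λ i → coeff a n₁ i * shift (p ℕ.* i) (coeff a n₀) m)
    coeff-lucas {n₀} n₀<p n₁ m = begin
      coeff a n m
        -- The range is completed to whole blocks of length p; the added weights contain C(n,k) with
        -- k > n.
        ≡⟨ weight-sum n (suc n₁ ℕ.* p) (λ k → Φ (ℤ.suc (expo n k)) m) n<p+pn₁ ⟨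
      ∑ (suc n₁ ℕ.* p) F
        ≡⟨ ∑-blocks p (suc n₁) F ⟩
      ∑ (suc n₁) (λ k₁ → ∑ p (λ k₀ → F (k₀ ℕ.+ p ℕ.* k₁)))
        ≡⟨ ∑-swap (suc n₁) p (λ k₁ k₀ → F (k₀ ℕ.+ p ℕ.* k₁)) ⟩
      ∑ p (λ k₀ → ∑ (suc n₁) (λ k₁ → F (k₀ ℕ.+ p ℕ.* k₁)))
        ≈⟨ ∑-≈ p block ⟩
      ∑ p (λ k₀ → weight a n₀ k₀ * ∑ (suc m) (λ i → coeff a n₁ i * shift (p ℕ.* i) (φ k₀) m))
        ≡⟨ ∑-cong p (λ k₀ _ → cong (weight a n₀ k₀ *_)
             (∑-cong (suc m) λ i _ → ℤP.*-comm (coeff a n₁ i) (shift (p ℕ.* i) (φ k₀) m))) ⟩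
      ∑ p (λ k₀ → weight a n₀ k₀ * ∑ (suc m) (λ i → shift (p ℕ.* i) (φ k₀) m * coeff a n₁ i))
        ≡⟨ ∑-bilinear p (suc m) (weight a n₀) (λ k₀ i → shift (p ℕ.* i) (φ k₀) m) (coeff a n₁) ⟩
      ∑ (suc m) (λ i → ∑ p (λ k₀ → weight a n₀ k₀ * shift (p ℕ.* i) (φ k₀) m) * coeff a n₁ i)
        ≡⟨ ∑-cong (suc m) (λ i _ → trans
             (cong (_* coeff a n₁ i) (trans
               (weight-sum n₀ p (λ k₀ → shift (p ℕ.* i) (φ k₀) m) n₀<p)
               (sym (shift-∑ (p ℕ.* i) (suc n₀) (weight a n₀) φ m))))
             (ℤP.*-comm (shift (p ℕ.* i) (coeff a n₀) m) (coeff a n₁ i))) ⟩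
      ∑ (suc m) (λ i → coeff a n₁ i * shift (p ℕ.* i) (coeff a n₀) m) ∎
      where
      open ≈-Reasoning
      n : ℕ
      n = n₀ ℕ.+ p ℕ.* n₁
      F : ℕ → ℤ
      F k = weight a n k * Φ (ℤ.suc (expo n k)) m
      φ : ℕ → ℕ → ℤ
      φ k₀ = Φ (ℤ.suc (expo n₀ k₀))
      n<p+pn₁ : n < suc n₁ ℕ.* p
      n<p+pn₁ = subst (n <_) (cong (p ℕ.+_) (ℕP.*-comm p n₁)) (ℕP.+-monoˡ-< (p ℕ.* n₁) n₀<p)
      lem : ∀ x y p u v → 1ℤ + (+ 5 * (x + p * y) - + 10 * (u + p * v))
        ≡ 1ℤ + (+ 5 * x - + 10 * u) + p * (+ 5 * y - + 10 * v)
      lem = solve-∀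
      index : ∀ k₀ k₁ → ℤ.suc (expo n (k₀ ℕ.+ p ℕ.* k₁)) ≡ ℤ.suc (expo n₀ k₀) + + p * expo n₁ k₁
      index k₀ k₁ = trans
        (cong₂ (λ x y → ℤ.suc (+ 5 * (+ n₀ + x) - + 10 * (+ k₀ + y))) (ℤP.pos-* p n₁) (ℤP.pos-* p k₁))
        (lem (+ n₀) (+ n₁) (+ p) (+ k₀) (+ k₁))
      term : ∀ k₀ → k₀ < p → ∀ k₁ → F (k₀ ℕ.+ p ℕ.* k₁)
        ≈ weight a n₀ k₀ * (weight a n₁ k₁ * Φ (ℤ.suc (expo n₀ k₀) + + p * expo n₁ k₁) m)
      term k₀ k₀<p k₁ = ≈-trans
        (*-cong (weight-lucas a n₀<p k₀<p n₁ k₁) (≈-reflexive (cong (λ K → Φ K m) (index k₀ k₁))))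
        (≈-reflexive (ℤP.*-assoc (weight a n₀ k₀) (weight a n₁ k₁) _))
      block : ∀ k₀ → k₀ < p → ∑ (suc n₁) (λ k₁ → F (k₀ ℕ.+ p ℕ.* k₁))
        ≈ weight a n₀ k₀ * ∑ (suc m) (λ i → coeff a n₁ i * shift (p ℕ.* i) (φ k₀) m)
      block k₀ k₀<p = begin
        ∑ (suc n₁) (λ k₁ → F (k₀ ℕ.+ p ℕ.* k₁))
          ≈⟨ ∑-≈ (suc n₁) (λ k₁ _ → term k₀ k₀<p k₁) ⟩
        ∑ (suc n₁) (λ k₁ → weight a n₀ k₀ * g k₁)
          ≡⟨ ∑-*ˡ (suc n₁) (weight a n₀ k₀) g ⟩
        weight a n₀ k₀ * ∑ (suc n₁) g
          ≈⟨ *-cong (≈-refl {weight a n₀ k₀}) (inner-sum a n₁ (ℤ.suc (expo n₀ k₀)) m) ⟩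
        weight a n₀ k₀ * ∑ (suc m) (λ i → coeff a n₁ i * shift (p ℕ.* i) (φ k₀) m) ∎
        where
        g : ℕ → ℤ
        g k₁ = weight a n₁ k₁ * Φ (ℤ.suc (expo n₀ k₀) + + p * expo n₁ k₁) m

  -- Vanishing of the coefficient at 3n₀ - 2p

  Deg⇒∑≈0 : ∀ d f → Deg d f → d < p → ∑ p f ≈ 0ℤ
  Deg⇒∑≈0 d f hf d<p = ≈-trans
    -- With T = Δ and S = 1 the operator T + S advances k by one, so F(p) ≡ F(0) + Δ^p F(0). Here
    -- F(0) = 0, and F, whose difference is f, has degree less than d + 1 ≤ p.
    (frobenius (λ k _ i → Δ^ i F k) (λ k _ i → Δ^-suc i F k))
    (≈-reflexive (trans (ℤP.+-identityˡ _) (Deg⇒Δ^≡0 p (Deg-mono {suc d} {p} {F} d<p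
      (Deg-cong d (λ k → sym (ΔF k)) hf)) 0)))
    where
    F : ℕ → ℤ
    F k = ∑ k f
    cancel : ∀ x y → x + y - x ≡ y
    cancel = solve-∀
    ΔF : ∀ k → Δ F k ≡ f k
    ΔF k = trans (cong (_- F k) (∑-last k f)) (cancel (F k) (f k))

  -- Since n ≡ -(m + 1), this is the reflection C(-m-1,k) = (-1)^k C(m+k,k). Pascal's rule carries
  -- it from m and k to their successors, starting from n = p - 1, where p divides C(p,k+1).
  signed-C : ∀ m n k → n ℕ.+ suc m ≡ p → k < p → sgn k * + (n C k) ≈ + ((m ℕ.+ k) C m)
  signed-C m n zero _ _ = ≈-reflexive (trans (ℤP.*-identityˡ _)
    (cong +_ (trans (C-zero n) (sym (trans (cong (_C m) (ℕP.+-identityʳ m)) (nCn≡1 m))))))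
  signed-C zero n (suc k) refl k<p = begin
    - sgn k * + (n C suc k)
      ≡⟨ lem (sgn k) (+ (n C k)) (+ (n C suc k)) ⟩
    sgn k * + (n C k) - sgn k * (+ (n C k) + + (n C suc k))
      ≡⟨ cong (λ x → sgn k * + (n C k) - sgn k * x)
           (trans (sym (pascal n k)) (cong (λ x → + (x C suc k)) (ℕP.+-comm 1 n))) ⟩
    sgn k * + (n C k) - sgn k * + (p C suc k)
      ≈⟨ +-cong (signed-C zero n k refl (ℕP.<⇒≤ k<p)) (neg-cong (*-zeroʳ (sgn k) (C≈0 (s≤s z≤n) k<p))) ⟩
    + (k C 0) - 0ℤ
      ≡⟨ ℤP.+-identityʳ _ ⟩
    + (k C 0)
      ≡⟨ cong +_ (trans (C-zero k) (sym (C-zero (suc k)))) ⟩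
    + (suc k C 0) ∎
    where
    open ≈-Reasoning
    lem : ∀ s x y → - s * y ≡ s * x - s * (x + y)
    lem = solve-∀
  signed-C (suc m) n (suc k) eq k<p = begin
    - sgn k * + (n C suc k)
      ≡⟨ lem (sgn k) (+ (n C k)) (+ (n C suc k)) ⟩
    - sgn k * (+ (n C k) + + (n C suc k)) + sgn k * + (n C k)
      ≡⟨ cong (λ x → - sgn k * x + sgn k * + (n C k)) (pascal n k) ⟨
    - sgn k * + (suc n C suc k) + sgn k * + (n C k)
      ≈⟨ +-cong (signed-C m (suc n) (suc k) (trans (sym (ℕP.+-suc n (suc m))) eq) k<p)
                (signed-C (suc m) n k eq (ℕP.<⇒≤ k<p)) ⟩
    + ((m ℕ.+ suc k) C m) + + ((suc m ℕ.+ k) C suc m)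
      ≡⟨ cong (λ x → + ((m ℕ.+ suc k) C m) + + (x C suc m)) (ℕP.+-suc m k) ⟨
    + ((m ℕ.+ suc k) C m) + + ((m ℕ.+ suc k) C suc m)
      ≡⟨ pascal (m ℕ.+ suc k) m ⟨
    + ((suc m ℕ.+ suc k) C suc m) ∎
    where
    open ≈-Reasoning
    lem : ∀ s x y → - s * y ≡ - s * (x + y) + s * x
    lem = solve-∀

  -- (-1)ᵏ C(n,k) ≡ C(m+k,m) when n + m + 1 = p, so an odd power a of it costs degree a·m;
  -- the vanishing below needs a ≤ 3.
  record PolynomialWeights (a : ℕ) : Set where
    field
      poly     : ℕ → ℕ → ℤ
      poly-deg : ∀ m → Deg (suc (3 ℕ.* m)) (poly m)
      weight≈  : ∀ m n k → n ℕ.+ suc m ≡ p → k < p → weight a n k ≈ poly m k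

  weights-1 : PolynomialWeights 1
  weights-1 = record
    { poly     = λ m k → + ((m ℕ.+ k) C m)
    ; poly-deg = λ m → Deg-mono {suc m} {suc (3 ℕ.* m)} {λ k → + ((m ℕ.+ k) C m)} (s≤s (ℕP.m≤n*m m 3)) (Deg-C m)
    ; weight≈  = λ m n k eq k<p → ≈-trans
        (≈-reflexive (cong (sgn k *_) (ℤP.*-identityʳ (+ (n C k))))) (signed-C m n k eq k<p)
    }

  -- As (-1)^k = (-1)^(3k), the weight is the cube of the signed binomial coefficient.
  weights-3 : PolynomialWeights 3
  weights-3 = record
    { poly     = λ m k → g m k * (g m k * g m k)
    ; poly-deg = λ m → subst (λ d → Deg (suc d) (λ k → g m k * (g m k * g m k))) (triple m)
        (Deg-* m (m ℕ.+ m) {g m} {λ k → g m k * g m k} (Deg-C m) (Deg-* m m {g m} {g m} (Deg-C m) (Deg-C m)))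
    ; weight≈  = λ m n k eq k<p → ≈-trans (≈-reflexive (sign-cubed k (+ (n C k))))
        (*-cong (signed-C m n k eq k<p) (*-cong (signed-C m n k eq k<p) (signed-C m n k eq k<p)))
    }
    where
    g : ℕ → ℕ → ℤ
    g m k = + ((m ℕ.+ k) C m)
    triple : ∀ m → m ℕ.+ (m ℕ.+ m) ≡ 3 ℕ.* m
    triple = ℕR.solve-∀
    lem₁ : ∀ s c → s * (c * (c * (c * 1ℤ))) ≡ 1ℤ * (s * (c * (c * c)))
    lem₁ = solve-∀
    lem₂ : ∀ s c → s * s * (s * (c * (c * c))) ≡ s * c * (s * c * (s * c))
    lem₂ = solve-∀
    sign-cubed : ∀ k c → sgn k * c ^ 3 ≡ sgn k * c * (sgn k * c * (sgn k * c))
    sign-cubed k c = trans (lem₁ (sgn k) c)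
      (trans (cong (_* (sgn k * (c * (c * c)))) (sym (sgn² k))) (lem₂ (sgn k) c))

  module _ (a : ℕ) .{{_ : ℕ.NonZero a}} (W : PolynomialWeights a) where

    open PolynomialWeights W

    -- Modulo p the sum runs over all residues k, and its summand is a polynomial in k of degree at most p - 3.
    coeff-vanishes : ∀ {n i} → n < p → 2 ℕ.* p ℕ.+ i ≡ 3 ℕ.* n → coeff a n i ≈ 0ℤ
    coeff-vanishes {n} {i} n<p eq = begin
      coeff a n i
        ≡⟨ weight-sum a n p (λ k → Φ (ℤ.suc (expo n k)) i) n<p ⟨
      ∑ p (λ k → weight a n k * Φ (ℤ.suc (expo n k)) i)
        ≈⟨ ∑-≈ p (λ k k<p → *-cong (weight≈ m n k n+m≡p k<p)
             (≈-reflexive (cong (λ M → Φ (ℤ.suc M) i) (index k)))) ⟩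
      ∑ p (λ k → poly m k * choose (c - + 5 * + k) i)
        ≈⟨ Deg⇒∑≈0 (suc (3 ℕ.* m ℕ.+ i)) (λ k → poly m k * choose (c - + 5 * + k) i)
             (Deg-* (3 ℕ.* m) i {poly m} {λ k → choose (c - + 5 * + k) i} (poly-deg m) (Deg-choose i c))
             small ⟩
      0ℤ ∎
      where
      open ≈-Reasoning
      m : ℕ
      m = p ∸ suc n
      n+m≡p : n ℕ.+ suc m ≡ p
      n+m≡p = trans (ℕP.+-suc n m) (ℕP.m+[n∸m]≡n n<p)
      -- Because i = 3n - 2p, the choice z = 4n - p - 5k gives 2z - i = 5n - 10k, so the Fibonacci
      -- coefficient at y^i is C(z,i), of degree at most i in k.
      c : ℤ
      c = + 4 * + n - + p
      lem : ∀ n p i k → + 5 * n - + 10 * k ≡ + 4 * n - p - + 5 * k + (+ 4 * n - p - + 5 * k) - i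
        + (+ 2 * p + i - + 3 * n)
      lem = solve-∀
      eqℤ : + 2 * + p + + i - + 3 * + n ≡ 0ℤ
      eqℤ = trans (cong₂ (λ x y → x + + i - y) (sym (ℤP.pos-* 2 p)) (sym (ℤP.pos-* 3 n)))
        (ℤP.i≡j⇒i-j≡0 {+ (2 ℕ.* p ℕ.+ i)} (cong +_ eq))
      index : ∀ k → expo n k ≡ c - + 5 * + k + (c - + 5 * + k) - + i
      index k = trans (lem (+ n) (+ p) (+ i) (+ k))
        (trans (cong (_+_ (c - + 5 * + k + (c - + 5 * + k) - + i)) eqℤ) (ℤP.+-identityʳ _))
      regroup₁ : ∀ m i p → 3 ℕ.+ (3 ℕ.* m ℕ.+ i) ℕ.+ 2 ℕ.* p ≡ 3 ℕ.+ 3 ℕ.* m ℕ.+ (2 ℕ.* p ℕ.+ i)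
      regroup₁ = ℕR.solve-∀
      regroup₂ : ∀ m n → 3 ℕ.+ 3 ℕ.* m ℕ.+ 3 ℕ.* n ≡ (n ℕ.+ suc m) ℕ.+ 2 ℕ.* (n ℕ.+ suc m)
      regroup₂ = ℕR.solve-∀
      -- The degree count 3m + i = 3(p - 1 - n) + (3n - 2p) = p - 3.
      exact : 3 ℕ.+ (3 ℕ.* m ℕ.+ i) ≡ p
      exact = ℕP.+-cancelʳ-≡ (2 ℕ.* p) _ _ (trans (regroup₁ m i p)
        (trans (cong (3 ℕ.+ 3 ℕ.* m ℕ.+_) eq) (trans (regroup₂ m n) (cong (λ x → x ℕ.+ 2 ℕ.* x) n+m≡p))))
      small : suc (3 ℕ.* m ℕ.+ i) < p
      small = ℕP.≤-trans (ℕP.n≤1+n _) (ℕP.≤-reflexive exact)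

    -- Isolating the central term

    sgn-3* : ∀ n → sgn (3 ℕ.* n) ≡ sgn n
    sgn-3* n = trans (cong sgn (lem n)) (trans (sgn-+ (n ℕ.+ n) n)
      (trans (cong (_* sgn n) (sgn-double n)) (ℤP.*-identityˡ _)))
      where
      lem : ∀ n → 3 ℕ.* n ≡ n ℕ.+ n ℕ.+ n
      lem = ℕR.solve-∀

    module _ {n₀ : ℕ} (n₀<p : n₀ < p) (n₁ : ℕ) where

      private
        m : ℕ
        m = 3 ℕ.* (n₀ ℕ.+ p ℕ.* n₁)

        m-expand : ∀ p n₀ n₁ → 3 ℕ.* (n₀ ℕ.+ p ℕ.* n₁) ≡ 3 ℕ.* n₀ ℕ.+ p ℕ.* (3 ℕ.* n₁)
        m-expand = ℕR.solve-∀

        term : ℕ → ℤ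
        term i = coeff a n₁ i * shift (p ℕ.* i) (coeff a n₀) m

        odd : ∀ i → sgn i ≡ - sgn n₁ → term i ≈ 0ℤ
        odd i h = *-zeroˡ _ (≈-reflexive (coeff-parity a n₁ i h))

        shift-at : ∀ i r → m ≡ p ℕ.* i ℕ.+ r → shift (p ℕ.* i) (coeff a n₀) m ≡ coeff a n₀ r
        shift-at i r eq = trans (cong (shift (p ℕ.* i) (coeff a n₀)) eq) (shift-+ (p ℕ.* i) (coeff a n₀) r)

        shift-past : ∀ i → m < p ℕ.* i → term i ≈ 0ℤ
        shift-past i m<pi = *-zeroʳ (coeff a n₁ i) (≈-reflexive (shift-< (p ℕ.* i) (coeff a n₀) m m<pi))

      central : term (3 ℕ.* n₁) ≡ coeff a n₁ (3 ℕ.* n₁) * coeff a n₀ (3 ℕ.* n₀)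
      central = cong (coeff a n₁ (3 ℕ.* n₁) *_) (shift-at (3 ℕ.* n₁) (3 ℕ.* n₀) (lem p n₀ n₁))
        where
        lem : ∀ p n₀ n₁ → 3 ℕ.* (n₀ ℕ.+ p ℕ.* n₁) ≡ p ℕ.* (3 ℕ.* n₁) ℕ.+ 3 ℕ.* n₀
        lem = ℕR.solve-∀

      -- The distance to the centre is o + 1. At distance one parity decides; from two on the
      -- partner exponent is at least 3n₀ + 2p ≥ 5n₀ + 2, beyond the degree of S_{n₀}.
      below : ∀ i o → suc i ℕ.+ o ≡ 3 ℕ.* n₁ → term i ≈ 0ℤ
      below i zero    eq = odd i (trans (sym (ℤP.neg-involutive (sgn i)))
        (cong -_ (trans (cong sgn (trans (sym (ℕP.+-identityʳ (suc i))) eq)) (sgn-3* n₁))))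
      below i (suc o) eq = *-zeroʳ (coeff a n₁ i) (≈-reflexive (trans
        (shift-at i (3 ℕ.* n₀ ℕ.+ p ℕ.* (2 ℕ.+ o))
          (trans (m-expand p n₀ n₁) (trans (cong (λ x → 3 ℕ.* n₀ ℕ.+ p ℕ.* x) (sym eq)) (regroup p n₀ i o))))
        (coeff-degree a n₀ _ large)))
        where
        regroup : ∀ p n₀ i o → 3 ℕ.* n₀ ℕ.+ p ℕ.* (suc i ℕ.+ suc o) ≡ p ℕ.* i ℕ.+ (3 ℕ.* n₀ ℕ.+ p ℕ.* (2 ℕ.+ o))
        regroup = ℕR.solve-∀
        split : ∀ n → suc (5 ℕ.* n) ℕ.+ 1 ≡ 3 ℕ.* n ℕ.+ suc n ℕ.* 2
        split = ℕR.solve-∀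
        large : suc (5 ℕ.* n₀) ≤ 3 ℕ.* n₀ ℕ.+ p ℕ.* (2 ℕ.+ o)
        large = ℕP.≤-trans (ℕP.m≤m+n _ 1) (ℕP.≤-trans (ℕP.≤-reflexive (split n₀))
          (ℕP.+-monoʳ-≤ (3 ℕ.* n₀) (ℕP.*-mono-≤ n₀<p (ℕP.m≤m+n 2 o))))

      beyond : ∀ i o → suc (3 ℕ.* n₁) ℕ.+ o ≡ i → 3 ℕ.* n₀ < p ℕ.* suc o → term i ≈ 0ℤ
      beyond i o refl 3n₀< = shift-past i (ℕP.≤-trans
        (ℕP.≤-reflexive (cong suc (m-expand p n₀ n₁)))
        (ℕP.≤-trans (ℕP.+-monoˡ-≤ (p ℕ.* (3 ℕ.* n₁)) 3n₀<) (ℕP.≤-reflexive (regroup p n₁ o))))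
        where
        regroup : ∀ p n₁ o → p ℕ.* suc o ℕ.+ p ℕ.* (3 ℕ.* n₁) ≡ p ℕ.* (suc (3 ℕ.* n₁) ℕ.+ o)
        regroup = ℕR.solve-∀

      -- The partner exponent is 3n₀ - p(o + 1), negative from distance three on. At distance two it
      -- is nonnegative exactly when 2p ≤ 3n₀, the case that calls for the polynomial weights.
      above : ∀ i o → suc (3 ℕ.* n₁) ℕ.+ o ≡ i → term i ≈ 0ℤ
      above i zero refl = odd i (cong -_ (trans (cong sgn (ℕP.+-identityʳ (3 ℕ.* n₁))) (sgn-3* n₁)))
      above i (suc zero) refl with 2 ℕ.* p ℕ.≤? 3 ℕ.* n₀
      ... | yes 2p≤3n₀ = *-zeroʳ (coeff a n₁ i) (≈-trans
        (≈-reflexive (shift-at i r (trans (m-expand p n₀ n₁)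
          (trans (cong (ℕ._+ p ℕ.* (3 ℕ.* n₁)) (sym 2p+r)) (regroup p n₁ r)))))
        (coeff-vanishes n₀<p 2p+r))
        where
        r : ℕ
        r = 3 ℕ.* n₀ ∸ 2 ℕ.* p
        2p+r : 2 ℕ.* p ℕ.+ r ≡ 3 ℕ.* n₀
        2p+r = ℕP.m+[n∸m]≡n 2p≤3n₀
        regroup : ∀ p n₁ r → 2 ℕ.* p ℕ.+ r ℕ.+ p ℕ.* (3 ℕ.* n₁) ≡ p ℕ.* (suc (3 ℕ.* n₁) ℕ.+ 1) ℕ.+ r
        regroup = ℕR.solve-∀
      ... | no 2p≰3n₀ = beyond i 1 refl
        (subst (3 ℕ.* n₀ <_) (ℕP.*-comm 2 p) (ℕP.≰⇒> 2p≰3n₀))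
      above i (suc (suc o)) refl = beyond i (2 ℕ.+ o) refl
        (ℕP.<-≤-trans (subst (3 ℕ.* n₀ <_) (ℕP.*-comm 3 p) (ℕP.*-monoʳ-< 3 n₀<p))
          (ℕP.*-monoʳ-≤ p (ℕP.m≤m+n 3 o)))

      off-centre : ∀ i → i ≢ 3 ℕ.* n₁ → term i ≈ 0ℤ
      off-centre i i≢ with ℕP.<-cmp i (3 ℕ.* n₁)
      ... | tri< i< _ _ = below i _ (ℕP.m+[n∸m]≡n i<)
      ... | tri≈ _ i≡ _ = contradiction i≡ i≢
      ... | tri> _ _ i> = above i _ (ℕP.m+[n∸m]≡n i>)

      A-lucas : A a (n₀ ℕ.+ p ℕ.* n₁) ≈ A a n₀ * A a n₁
      A-lucas = begin
        A a (n₀ ℕ.+ p ℕ.* n₁)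
          ≡⟨ A≡coeff a (n₀ ℕ.+ p ℕ.* n₁) ⟩
        coeff a (n₀ ℕ.+ p ℕ.* n₁) m
          ≈⟨ coeff-lucas a n₀<p n₁ m ⟩
        ∑ (suc m) term
          ≈⟨ ∑-single (suc m) term (3 ℕ.* n₁) (s≤s in-range) (λ i _ → off-centre i) ⟩
        term (3 ℕ.* n₁)
          ≡⟨ central ⟩
        coeff a n₁ (3 ℕ.* n₁) * coeff a n₀ (3 ℕ.* n₀)
          ≡⟨ ℤP.*-comm (coeff a n₁ (3 ℕ.* n₁)) (coeff a n₀ (3 ℕ.* n₀)) ⟩
        coeff a n₀ (3 ℕ.* n₀) * coeff a n₁ (3 ℕ.* n₁)
          ≡⟨ cong₂ _*_ (A≡coeff a n₀) (A≡coeff a n₁) ⟨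
        A a n₀ * A a n₁ ∎
        where
        open ≈-Reasoning
        in-range : 3 ℕ.* n₁ ≤ m
        in-range = ℕP.*-monoʳ-≤ 3 (ℕP.≤-trans (ℕP.m≤n*m n₁ p {{ℕ.>-nonZero 0<p}}) (ℕP.m≤n+m (p ℕ.* n₁) n₀))

    -- The value A(0) = 1 settles the empty digit list; each further list splits off its lowest
    -- digit by `A-lucas`.
    A-digits : A a 0 ≡ 1ℤ → ∀ ds → All (_< p) ds → A a (digitsValue p ds) ≈ prodA a ds
    A-digits A0 []       []            = ≈-reflexive A0
    A-digits A0 (d ∷ ds) (d<p ∷ ds<p) = ≈-trans (A-lucas d<p (digitsValue p ds))
      (*-cong (≈-refl {A a d}) (A-digits A0 ds ds<p))

theorem4p3 : (a : ℕ) → a ≡ 1 ⊎ a ≡ 3 → (p : ℕ) → Prime p →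
    (ds : List ℕ) → All (_< p) ds →
    (+ p) ∣ (A a (digitsValue p ds) - prodA a ds)
theorem4p3 a (inj₁ refl) p pr ds ds<p = ≈⇒∣ (A-digits 1 weights-1 refl ds ds<p)
  where open LucasStep p pr
theorem4p3 a (inj₂ refl) p pr ds ds<p = ≈⇒∣ (A-digits 3 weights-3 refl ds ds<p)
  where open LucasStep p pr
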